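{- Let $d\ge 1$ and let $f(t)=1+\sum_{i=1}^{d}\binom{x_i}{i}t^{i}$ be a polynomial of degree $d$ with positive real coefficients, where $x_1,\dots,x_d$ are real numbers with $x_i\ge i-1$. Suppose $f(t)$ is ultra log-concave and $x_d\ge d$. Then $x_1\ge x_2\ge\cdots\ge x_d$.
   Context: For a real number $x$ and an integer $k\ge 0$, $\binom{x}{k}=\frac{x(x-1)\cdots(x-k+1)}{k!}$. For every integer $k\ge1$ and real $y>0$ there is a unique real $x\ge k-1$ with $y=\binom{x}{k}$, so the $x_i$ are uniquely determined by the coefficients. A polynomial $a_0+a_1t+\cdots+a_dt^d$ of degree $d$ is called ultra log-concave if $\big(a_i/\binom{d}{i}\big)^2\ge \frac{a_{i-1}}{\binom{d}{i-1}}\cdot\frac{a_{i+1}}{\binom{d}{i+1}}$ for all $1\le i\le d-1$. -}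

module Defs where

open import Data.Fin.Base using (Fin; toℕ; fromℕ)
open import Data.Fin.Properties using (toℕ≤pred[n])
open import Data.Integer.Base using (+_)
open import Data.Nat.Base as ℕ using (ℕ; zero; suc; z≤n; s≤s; _⊔_; _!)
open import Data.Nat.Combinatorics using (_C_; nCk+nC[k+1]≡[n+1]C[k+1])
open import Data.Nat.Properties as ℕₚ using (_!≢0)
open import Data.Product.Base using (∃-syntax; _×_; _,_)
open import Data.Rational.Base
  using (ℚ; 0ℚ; 1ℚ; ½; _+_; _*_; _-_; -_; ∣_∣; _≤_; _<_; 1/_; _/_;
         NonZero; Positive; positive; nonNegative)
open import Data.Rational.Properties as ℚₚ
open import Data.Rational.Solver using (module +-*-Solver)
open import Relation.Binary.PropositionalEquality
open import Relation.Nullary.Negation.Core using (¬_)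

-- Real numbers are Cauchy sequences of rationals; their equality is _≃_.

IsCauchy : (ℕ → ℚ) → Set
IsCauchy a = ∀ ε → 0ℚ < ε →
  ∃[ N ] (∀ m n → N ℕ.≤ m → N ℕ.≤ n → ∣ a m - a n ∣ ≤ ε)

record ℝ : Set where
  constructor mkℝ
  field
    seq    : ℕ → ℚ
    cauchy : IsCauchy seq

open ℝ public

infix 4 _≃_ _≤ℝ_ _<ℝ_

_≃_ : ℝ → ℝ → Set
x ≃ y = ∀ ε → 0ℚ < ε → ∃[ N ] (∀ n → N ℕ.≤ n → ∣ seq x n - seq y n ∣ ≤ ε)

_≤ℝ_ : ℝ → ℝ → Set
x ≤ℝ y = ∀ ε → 0ℚ < ε → ∃[ N ] (∀ n → N ℕ.≤ n → seq x n ≤ seq y n + ε)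

_<ℝ_ : ℝ → ℝ → Set
x <ℝ y = ∃[ ε ] (0ℚ < ε × ∃[ N ] (∀ n → N ℕ.≤ n → seq x n + ε ≤ seq y n))

-- Abstract, so that conversion checking never unfolds these proofs.
private
  abstract
    const-cauchy : ∀ p → IsCauchy (λ _ → p)
    const-cauchy p ε 0<ε = 0 , λ _ _ _ _ →
      ≤-trans (≤-reflexive (cong ∣_∣ (+-inverseʳ p))) (<⇒≤ 0<ε)

    half-pos : ∀ ε → 0ℚ < ε → 0ℚ < ½ * ε
    half-pos ε 0<ε = positive⁻¹ (½ * ε) {{pos*pos⇒pos ½ ε {{positive 0<ε}}}}

    ½+½ : ∀ ε → ½ * ε + ½ * ε ≡ ε
    ½+½ ε = trans (sym (*-distribʳ-+ ε ½ ½)) (*-identityˡ ε)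

    +-cauchy : ∀ a b → IsCauchy a → IsCauchy b → IsCauchy (λ n → a n + b n)
    +-cauchy a b ca cb ε 0<ε
      with ca (½ * ε) (half-pos ε 0<ε) | cb (½ * ε) (half-pos ε 0<ε)
    ... | M , a-close | N , b-close = M ⊔ N , λ m n p q → begin
        ∣ (a m + b m) - (a n + b n) ∣     ≡⟨ cong ∣_∣ (rearrange (a m) (b m) (a n) (b n)) ⟩
        ∣ (a m - a n) + (b m - b n) ∣     ≤⟨ ∣p+q∣≤∣p∣+∣q∣ (a m - a n) (b m - b n) ⟩
        ∣ a m - a n ∣ + ∣ b m - b n ∣
          ≤⟨ +-mono-≤ (a-close m n (ℕₚ.m⊔n≤o⇒m≤o M N p) (ℕₚ.m⊔n≤o⇒m≤o M N q))
                      (b-close m n (ℕₚ.m⊔n≤o⇒n≤o M N p) (ℕₚ.m⊔n≤o⇒n≤o M N q)) ⟩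
        ½ * ε + ½ * ε                     ≡⟨ ½+½ ε ⟩
        ε                                 ∎
      where
      open ≤-Reasoning
      rearrange : ∀ p q r s → (p + q) - (r + s) ≡ (p - r) + (q - s)
      rearrange = solve 4 (λ p q r s → (p :+ q) :- (r :+ s) := (p :- r) :+ (q :- s)) refl
        where open +-*-Solver

    neg-cauchy : ∀ a → IsCauchy a → IsCauchy (λ n → - a n)
    neg-cauchy a ca ε 0<ε with ca ε 0<ε
    ... | N , close = N , λ m n p q → begin
        ∣ - a m - - a n ∣   ≡⟨ cong ∣_∣ (rearrange (a m) (a n)) ⟩
        ∣ - (a m - a n) ∣   ≡⟨ ∣-p∣≡∣p∣ (a m - a n) ⟩
        ∣ a m - a n ∣       ≤⟨ close m n p q ⟩
        ε                   ∎
      where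
      open ≤-Reasoning
      rearrange : ∀ p q → - p - - q ≡ - (p - q)
      rearrange = solve 2 (λ p q → (:- p) :- (:- q) := :- (p :- q)) refl
        where open +-*-Solver

    eventually-bounded : ∀ a → IsCauchy a →
      ∃[ B ] (0ℚ < B × ∃[ N ] (∀ n → N ℕ.≤ n → ∣ a n ∣ ≤ B))
    eventually-bounded a ca with ca 1ℚ (positive⁻¹ 1ℚ)
    ... | N , close = ∣ a N ∣ + 1ℚ , +-mono-≤-< (0≤∣p∣ (a N)) (positive⁻¹ 1ℚ) , N , λ n N≤n → begin
        ∣ a n ∣                   ≡⟨ cong ∣_∣ (rearrange (a n) (a N)) ⟩
        ∣ a N + (a n - a N) ∣     ≤⟨ ∣p+q∣≤∣p∣+∣q∣ (a N) (a n - a N) ⟩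
        ∣ a N ∣ + ∣ a n - a N ∣   ≤⟨ +-monoʳ-≤ ∣ a N ∣ (close n N N≤n ℕₚ.≤-refl) ⟩
        ∣ a N ∣ + 1ℚ              ∎
      where
      open ≤-Reasoning
      rearrange : ∀ p q → p ≡ q + (p - q)
      rearrange = solve 2 (λ p q → p := q :+ (p :- q)) refl
        where open +-*-Solver

    scale : ∀ s ε → 0ℚ < s → 0ℚ < ε → ∃[ δ ] (0ℚ < δ × s * δ ≡ ε)
    scale s ε 0<s 0<ε = 1/ s * ε ,
      positive⁻¹ (1/ s * ε) {{pos*pos⇒pos (1/ s) {{1/pos⇒pos s}} ε {{positive 0<ε}}}} ,
      trans (sym (*-assoc s (1/ s) ε))
        (trans (cong (_* ε) (*-inverseʳ s)) (*-identityˡ ε))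
      where
      instance
        s-pos : Positive s
        s-pos = positive 0<s
        s≢0 : NonZero s
        s≢0 = pos⇒nonZero s

    *-bound : ∀ p q {B δ} → 0ℚ < B → ∣ p ∣ ≤ B → ∣ q ∣ ≤ δ → ∣ p * q ∣ ≤ B * δ
    *-bound p q {B} {δ} 0<B p≤B q≤δ = begin
      ∣ p * q ∣       ≡⟨ ∣p*q∣≡∣p∣*∣q∣ p q ⟩
      ∣ p ∣ * ∣ q ∣   ≤⟨ *-monoʳ-≤-nonNeg ∣ q ∣ {{nonNegative (0≤∣p∣ q)}} p≤B ⟩
      B * ∣ q ∣       ≤⟨ *-monoˡ-≤-nonNeg B {{nonNegative (<⇒≤ 0<B)}} q≤δ ⟩
      B * δ           ∎
      where open ≤-Reasoning

    *-close : ∀ p q r s {A B δ} → 0ℚ < A → 0ℚ < B → ∣ p ∣ ≤ A → ∣ s ∣ ≤ B →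
      ∣ p - r ∣ ≤ δ → ∣ q - s ∣ ≤ δ → ∣ p * q - r * s ∣ ≤ (A + B) * δ
    *-close p q r s {A} {B} {δ} 0<A 0<B p≤A s≤B pr≤δ qs≤δ = begin
      ∣ p * q - r * s ∣                   ≡⟨ cong ∣_∣ (rearrange p q r s) ⟩
      ∣ p * (q - s) + s * (p - r) ∣       ≤⟨ ∣p+q∣≤∣p∣+∣q∣ (p * (q - s)) (s * (p - r)) ⟩
      ∣ p * (q - s) ∣ + ∣ s * (p - r) ∣   ≤⟨ +-mono-≤ (*-bound p (q - s) 0<A p≤A qs≤δ)
                                                      (*-bound s (p - r) 0<B s≤B pr≤δ) ⟩
      A * δ + B * δ                       ≡⟨ *-distribʳ-+ δ A B ⟨
      (A + B) * δ                         ∎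
      where
      open ≤-Reasoning
      rearrange : ∀ p q r s → p * q - r * s ≡ p * (q - s) + s * (p - r)
      rearrange = solve 4 (λ p q r s →
        p :* q :- r :* s := p :* (q :- s) :+ s :* (p :- r)) refl
        where open +-*-Solver

    *-cauchy : ∀ a b → IsCauchy a → IsCauchy b → IsCauchy (λ n → a n * b n)
    *-cauchy a b ca cb ε 0<ε =
      let A , 0<A , N₁ , a≤A = eventually-bounded a ca
          B , 0<B , N₂ , b≤B = eventually-bounded b cb
          δ , 0<δ , Sδ≡ε = scale (A + B) ε (+-mono-< 0<A 0<B) 0<ε
      in combine 0<A 0<B N₁ a≤A N₂ b≤B Sδ≡ε (ca δ 0<δ) (cb δ 0<δ)
      where
      combine : ∀ {A B δ} → 0ℚ < A → 0ℚ < B →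
        ∀ N₁ → (∀ n → N₁ ℕ.≤ n → ∣ a n ∣ ≤ A) →
        ∀ N₂ → (∀ n → N₂ ℕ.≤ n → ∣ b n ∣ ≤ B) →
        (A + B) * δ ≡ ε →
        ∃[ M ] (∀ m n → M ℕ.≤ m → M ℕ.≤ n → ∣ a m - a n ∣ ≤ δ) →
        ∃[ M ] (∀ m n → M ℕ.≤ m → M ℕ.≤ n → ∣ b m - b n ∣ ≤ δ) →
        ∃[ N ] (∀ m n → N ℕ.≤ m → N ℕ.≤ n → ∣ a m * b m - a n * b n ∣ ≤ ε)
      combine 0<A 0<B N₁ a≤A N₂ b≤B Sδ≡ε (M₁ , a-close) (M₂ , b-close) =
        (N₁ ⊔ N₂) ⊔ (M₁ ⊔ M₂) , λ m n p q →
          let p₁ = ℕₚ.m⊔n≤o⇒m≤o (N₁ ⊔ N₂) (M₁ ⊔ M₂) p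
              p₂ = ℕₚ.m⊔n≤o⇒n≤o (N₁ ⊔ N₂) (M₁ ⊔ M₂) p
              q₁ = ℕₚ.m⊔n≤o⇒m≤o (N₁ ⊔ N₂) (M₁ ⊔ M₂) q
              q₂ = ℕₚ.m⊔n≤o⇒n≤o (N₁ ⊔ N₂) (M₁ ⊔ M₂) q
          in ≤-trans
            (*-close (a m) (b m) (a n) (b n) 0<A 0<B
              (a≤A m (ℕₚ.m⊔n≤o⇒m≤o N₁ N₂ p₁))
              (b≤B n (ℕₚ.m⊔n≤o⇒n≤o N₁ N₂ q₁))
              (a-close m n (ℕₚ.m⊔n≤o⇒m≤o M₁ M₂ p₂) (ℕₚ.m⊔n≤o⇒m≤o M₁ M₂ q₂))
              (b-close m n (ℕₚ.m⊔n≤o⇒n≤o M₁ M₂ p₂) (ℕₚ.m⊔n≤o⇒n≤o M₁ M₂ q₂)))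
            (≤-reflexive Sδ≡ε)

infixl 6 _+ℝ_ _-ℝ_
infixl 7 _*ℝ_ _÷_
infix  8 -ℝ_

fromℚ : ℚ → ℝ
fromℚ p = mkℝ (λ _ → p) (const-cauchy p)

⟦_⟧ : ℕ → ℝ
⟦ n ⟧ = fromℚ (+ n / 1)

_+ℝ_ : ℝ → ℝ → ℝ
x +ℝ y = mkℝ (λ n → seq x n + seq y n) (+-cauchy (seq x) (seq y) (cauchy x) (cauchy y))

-ℝ_ : ℝ → ℝ
-ℝ x = mkℝ (λ n → - seq x n) (neg-cauchy (seq x) (cauchy x))

_-ℝ_ : ℝ → ℝ → ℝ
x -ℝ y = x +ℝ (-ℝ y)

_*ℝ_ : ℝ → ℝ → ℝ
x *ℝ y = mkℝ (λ n → seq x n * seq y n) (*-cauchy (seq x) (seq y) (cauchy x) (cauchy y))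

-- Only division by nonzero natural numbers is needed.
_÷_ : ℝ → (n : ℕ) → .{{_ : ℕ.NonZero n}} → ℝ
x ÷ n = x *ℝ fromℚ (+ 1 / n)

-- fallingFactorial x k = x (x - 1) ⋯ (x - k + 1)
fallingFactorial : ℝ → ℕ → ℝ
fallingFactorial x zero    = ⟦ 1 ⟧
fallingFactorial x (suc k) = fallingFactorial x k *ℝ (x -ℝ ⟦ k ⟧)

binom : ℝ → ℕ → ℝ
binom x k = (fallingFactorial x k ÷ (k !)) {{k !≢0}}

-- Real polynomials of degree exactly d; coeff i is the coefficient of tⁱ.
record Polynomial (d : ℕ) : Set where
  field
    coeff     : Fin (suc d) → ℝ
    leading≄0 : ¬ (coeff (fromℕ d) ≃ ⟦ 0 ⟧)

open Polynomial public

nCk≢0 : ∀ n k → k ℕ.≤ n → ℕ.NonZero (n C k)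
nCk≢0 n       zero    _         = _
nCk≢0 (suc n) (suc k) (s≤s k≤n) = ℕ.>-nonZero (begin-strict
  0                     <⟨ ℕ.>-nonZero⁻¹ (n C k) {{nCk≢0 n k k≤n}} ⟩
  n C k                 ≤⟨ ℕₚ.m≤m+n (n C k) (n C suc k) ⟩
  n C k ℕ.+ n C suc k   ≡⟨ nCk+nC[k+1]≡[n+1]C[k+1] n k ⟩
  suc n C suc k         ∎)
  where open ℕₚ.≤-Reasoning

normalised : ∀ {d} → Polynomial d → Fin (suc d) → ℝ
normalised {d} f i = (coeff f i ÷ (d C toℕ i)) {{nCk≢0 d (toℕ i) (toℕ≤pred[n] i)}}

-- Here h, i, j are the exponents i - 1, i, i + 1; such a triple in Fin (suc d)
-- exists exactly for the middle indices 1 ≤ i ≤ d - 1.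
UltraLogConcave : ∀ {d} → Polynomial d → Set
UltraLogConcave {d} f =
  ∀ (h i j : Fin (suc d)) → toℕ i ≡ suc (toℕ h) → toℕ j ≡ suc (toℕ i) →
  normalised f h *ℝ normalised f j ≤ℝ normalised f i *ℝ normalised f i

{-# OPTIONS --safe #-}

-- Let p i = aᵢ / binom(d, i) = ∏ (x i - j) / (d - j) over j < i.  As p 0 = 1, log-concavity
-- makes the means p i ^ (1 / i) decrease, and p d ≥ 1 then forces p i ≥ 1 and x i ≥ d.
-- If x i < y = x (i + 1), the factors (y - j) / (d - j) increase with j because y ≥ d, so
-- their geometric mean over j < i, which strictly exceeds p i ^ (1 / i), is at most the mean
-- p (i + 1) ^ (1 / (i + 1)) over j < i + 1: a contradiction.  Arguing by contradiction is
-- constructively valid here, as x ≤ y is the negation of y < x for Cauchy reals.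
module Submission where

open import Defs
open import Algebra.Bundles using (CommutativeMonoid; CommutativeRing)
import Algebra.Properties.CommutativeSemiring.Exp as Exp
open import Algebra.Structures using (IsCommutativeRing)
open import Data.Nat.Base as ℕ using (ℕ; zero; suc; z≤n; s≤s; _∸_)
import Data.Nat.Properties as ℕₚ
open import Data.Product.Base using (_×_; _,_; ∃-syntax)
open import Data.Sum.Base using (inj₁; inj₂)
open import Level using (0ℓ; _⊔_) renaming (suc to lsuc)
open import Relation.Binary.Core using (Rel)
open import Relation.Binary.PropositionalEquality as ≡ using (_≡_; cong; cong₂; subst)
import Relation.Binary.Reasoning.Base.Triple as Triple
open import Relation.Binary.Structures using (IsEquivalence; IsPreorder)
open import Relation.Nullary.Decidable.Core using (yes; no)
open import Relation.Nullary.Negation.Core using (¬_; contradiction)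

-- No roots are taken: comparing the geometric means of i and of i + 1 numbers becomes comparing an
-- (i + 1)-th power of one product with an i-th power of the other. The whole inequality argument
-- can then be run in an ordered commutative ring, with the reciprocals of d - j supplied as a given
-- family. The obstacle is that the order of the reals is not decidable. In place of trichotomy, the
-- only law that turns a refutation into an inequality is `≮⇒≥`, so even cancelling a positive
-- factor or extracting a root is done by refuting a strict inequality. The condition x i ≥ i - 1
-- puts x i on the branch where all numerators of binom(x i, i) are nonnegative and the binomial is
-- strictly increasing. This is what lets comparisons of values be turned into comparisons of
-- arguments.

record OrderedCommutativeRing c ℓ ℓ₁ ℓ₂ : Set (lsuc (c ⊔ ℓ ⊔ ℓ₁ ⊔ ℓ₂)) where
  field
    commutativeRing : CommutativeRing c ℓ

  open CommutativeRing commutativeRing public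

  infix 4 _≤_ _<_

  field
    _≤_          : Rel Carrier ℓ₁
    _<_          : Rel Carrier ℓ₂
    ≤-isPreorder : IsPreorder _≈_ _≤_
    <⇒≤          : ∀ {x y} → x < y → x ≤ y
    <-irrefl     : ∀ {x} → ¬ (x < x)
    <-≤-trans    : ∀ {x y z} → x < y → y ≤ z → x < z
    ≤-<-trans    : ∀ {x y z} → x ≤ y → y < z → x < z
    ≮⇒≥          : ∀ {x y} → ¬ (x < y) → y ≤ x
    0<1          : 0# < 1#
    +-monoˡ-≤    : ∀ z {x y} → x ≤ y → x + z ≤ y + z
    +-monoˡ-<    : ∀ z {x y} → x < y → x + z < y + z
    *-monoˡ-≤    : ∀ {x y z} → 0# ≤ z → x ≤ y → x * z ≤ y * z
    *-monoˡ-<    : ∀ {x y z} → 0# < z → x < y → x * z < y * z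

  open IsPreorder ≤-isPreorder public
    using () renaming (refl to ≤-refl; reflexive to ≤-reflexive; trans to ≤-trans)

  module ≤-Reasoning = Triple ≤-isPreorder
    (λ x<y y<x → <-irrefl (<-≤-trans x<y (<⇒≤ y<x)))
    (λ x<y y<z → <-≤-trans x<y (<⇒≤ y<z))
    ((λ y≈z x<y → <-≤-trans x<y (≤-reflexive y≈z)) ,
     (λ x≈y x<z → ≤-<-trans (≤-reflexive (sym x≈y)) x<z))
    <⇒≤ <-≤-trans ≤-<-trans

-- Powers and finite products in an ordered ring.

module OrderedRingProperties {c ℓ ℓ₁ ℓ₂} (R : OrderedCommutativeRing c ℓ ℓ₁ ℓ₂) where

  open OrderedCommutativeRing R
  open Exp commutativeSemiring using (_^_; ^-distrib-*)
  open ≤-Reasoning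

  0≤1 : 0# ≤ 1#
  0≤1 = <⇒≤ 0<1

  x≤y⇒0≤y-x : ∀ {x y} → x ≤ y → 0# ≤ y - x
  x≤y⇒0≤y-x {x} {y} x≤y = begin
    0#     ≈⟨ -‿inverseʳ x ⟨
    x - x  ≤⟨ +-monoˡ-≤ (- x) x≤y ⟩
    y - x  ∎

  *-monoʳ-≤ : ∀ {x y z} → 0# ≤ z → x ≤ y → z * x ≤ z * y
  *-monoʳ-≤ {x} {y} {z} 0≤z x≤y = begin
    z * x  ≈⟨ *-comm z x ⟩
    x * z  ≤⟨ *-monoˡ-≤ 0≤z x≤y ⟩
    y * z  ≈⟨ *-comm y z ⟩
    z * y  ∎

  *-mono-≤ : ∀ {x y u v} → 0# ≤ x → 0# ≤ v → x ≤ y → u ≤ v → x * u ≤ y * v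
  *-mono-≤ 0≤x 0≤v x≤y u≤v = ≤-trans (*-monoʳ-≤ 0≤x u≤v) (*-monoˡ-≤ 0≤v x≤y)

  *-mono-<-≤ : ∀ {x y u v} → 0# ≤ x → 0# < v → x < y → u ≤ v → x * u < y * v
  *-mono-<-≤ 0≤x 0<v x<y u≤v = ≤-<-trans (*-monoʳ-≤ 0≤x u≤v) (*-monoˡ-< 0<v x<y)

  *-nonNeg : ∀ {x y} → 0# ≤ x → 0# ≤ y → 0# ≤ x * y
  *-nonNeg {x} {y} 0≤x 0≤y = begin
    0#      ≈⟨ zeroˡ y ⟨
    0# * y  ≤⟨ *-monoˡ-≤ 0≤y 0≤x ⟩
    x * y   ∎

  *-pos : ∀ {x y} → 0# < x → 0# < y → 0# < x * y
  *-pos {x} {y} 0<x 0<y = begin-strict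
    0#      ≈⟨ zeroˡ y ⟨
    0# * y  <⟨ *-monoˡ-< 0<y 0<x ⟩
    x * y   ∎

  -- A strict inequality the other way would survive multiplication by `z`, so the factor cancels
  -- without an inverse of `z`.
  *-cancelʳ-≤ : ∀ {x y z} → 0# < z → x * z ≤ y * z → x ≤ y
  *-cancelʳ-≤ 0<z xz≤yz = ≮⇒≥ λ y<x → <-irrefl (<-≤-trans (*-monoˡ-< 0<z y<x) xz≤yz)

  1≤x*y : ∀ {x y} → 1# ≤ x → 1# ≤ y → 1# ≤ x * y
  1≤x*y {x} {y} 1≤x 1≤y = begin
    1#       ≈⟨ *-identityˡ 1# ⟨
    1# * 1#  ≤⟨ *-mono-≤ 0≤1 (≤-trans 0≤1 1≤y) 1≤x 1≤y ⟩
    x * y    ∎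

  ^-nonNeg : ∀ {x} → 0# ≤ x → ∀ n → 0# ≤ x ^ n
  ^-nonNeg 0≤x zero    = 0≤1
  ^-nonNeg 0≤x (suc n) = *-nonNeg 0≤x (^-nonNeg 0≤x n)

  ^-pos : ∀ {x} → 0# < x → ∀ n → 0# < x ^ n
  ^-pos 0<x zero    = 0<1
  ^-pos 0<x (suc n) = *-pos 0<x (^-pos 0<x n)

  ^-mono-≤ : ∀ {x y} → 0# ≤ x → x ≤ y → ∀ n → x ^ n ≤ y ^ n
  ^-mono-≤ 0≤x x≤y zero    = ≤-refl
  ^-mono-≤ 0≤x x≤y (suc n) =
    *-mono-≤ 0≤x (^-nonNeg (≤-trans 0≤x x≤y) n) x≤y (^-mono-≤ 0≤x x≤y n)

  ^-mono-< : ∀ {x y} → 0# ≤ x → x < y → ∀ n → x ^ suc n < y ^ suc n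
  ^-mono-< 0≤x x<y n =
    *-mono-<-≤ 0≤x (^-pos (≤-<-trans 0≤x x<y) n) x<y (^-mono-≤ 0≤x (<⇒≤ x<y) n)

  1≤x^n : ∀ {x} → 1# ≤ x → ∀ n → 1# ≤ x ^ n
  1≤x^n 1≤x zero    = ≤-refl
  1≤x^n 1≤x (suc n) = 1≤x*y 1≤x (1≤x^n 1≤x n)

  1^n≈1 : ∀ n → 1# ^ n ≈ 1#
  1^n≈1 zero    = refl
  1^n≈1 (suc n) = trans (*-identityˡ (1# ^ n)) (1^n≈1 n)

  1≤x^[1+n]⇒1≤x : ∀ {x} → 0# ≤ x → ∀ n → 1# ≤ x ^ suc n → 1# ≤ x
  1≤x^[1+n]⇒1≤x {x} 0≤x n 1≤x^ = ≮⇒≥ λ x<1 → <-irrefl (begin-strict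
    1#          ≤⟨ 1≤x^ ⟩
    x ^ suc n   <⟨ ^-mono-< 0≤x x<1 n ⟩
    1# ^ suc n  ≈⟨ 1^n≈1 (suc n) ⟩
    1#          ∎)

  ∏ : (ℕ → Carrier) → ℕ → Carrier
  ∏ f zero    = 1#
  ∏ f (suc n) = ∏ f n * f n

  ∏-≈1 : ∀ f n → (∀ j → j ℕ.< n → f j ≈ 1#) → ∏ f n ≈ 1#
  ∏-≈1 f zero    _   = refl
  ∏-≈1 f (suc n) f≈1 = trans
    (*-cong (∏-≈1 f n λ j j<n → f≈1 j (ℕₚ.m<n⇒m<1+n j<n)) (f≈1 n (ℕₚ.n<1+n n)))
    (*-identityˡ 1#)

  1≤∏ : ∀ f n → (∀ j → j ℕ.< n → 1# ≤ f j) → 1# ≤ ∏ f n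
  1≤∏ f zero    _   = ≤-refl
  1≤∏ f (suc n) 1≤f =
    1≤x*y (1≤∏ f n λ j j<n → 1≤f j (ℕₚ.m<n⇒m<1+n j<n)) (1≤f n (ℕₚ.n<1+n n))

  ∏-nonNeg : ∀ f n → (∀ j → j ℕ.< n → 0# ≤ f j) → 0# ≤ ∏ f n
  ∏-nonNeg f zero    _   = 0≤1
  ∏-nonNeg f (suc n) 0≤f =
    *-nonNeg (∏-nonNeg f n λ j j<n → 0≤f j (ℕₚ.m<n⇒m<1+n j<n)) (0≤f n (ℕₚ.n<1+n n))

  -- Each `g j` lies strictly above a nonnegative number and is therefore positive, so strictness
  -- survives even where factors of `f` vanish. Empty products would be equal, hence the `suc n`.
  ∏-mono-< : ∀ f g n → (∀ j → j ℕ.≤ n → 0# ≤ f j) → (∀ j → j ℕ.≤ n → f j < g j) →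
    ∏ f (suc n) < ∏ g (suc n)
  ∏-mono-< f g zero    0≤f f<g = begin-strict
    1# * f 0  ≈⟨ *-identityˡ (f 0) ⟩
    f 0       <⟨ f<g 0 z≤n ⟩
    g 0       ≈⟨ *-identityˡ (g 0) ⟨
    1# * g 0  ∎
  ∏-mono-< f g (suc n) 0≤f f<g =
    *-mono-<-≤ (∏-nonNeg f (suc n) λ { j (s≤s j≤n) → 0≤f j (ℕₚ.m≤n⇒m≤1+n j≤n) })
      (≤-<-trans (0≤f (suc n) ℕₚ.≤-refl) (f<g (suc n) ℕₚ.≤-refl))
      (∏-mono-< f g n (λ j j≤n → 0≤f j (ℕₚ.m≤n⇒m≤1+n j≤n)) λ j j≤n → f<g j (ℕₚ.m≤n⇒m≤1+n j≤n))
      (<⇒≤ (f<g (suc n) ℕₚ.≤-refl))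

  ∏≤b^n : ∀ f {b} n → 0# ≤ b → (∀ j → j ℕ.< n → 0# ≤ f j) → (∀ j → j ℕ.< n → f j ≤ b) →
    ∏ f n ≤ b ^ n
  ∏≤b^n f     zero    _   _   _   = ≤-refl
  ∏≤b^n f {b} (suc n) 0≤b 0≤f f≤b = begin
    ∏ f n * f n  ≤⟨ *-mono-≤ (∏-nonNeg f n λ j j<n → 0≤f j (ℕₚ.m<n⇒m<1+n j<n)) 0≤b
                      (∏≤b^n f n 0≤b (λ j j<n → 0≤f j (ℕₚ.m<n⇒m<1+n j<n))
                                     (λ j j<n → f≤b j (ℕₚ.m<n⇒m<1+n j<n)))
                      (f≤b n (ℕₚ.n<1+n n)) ⟩
    b ^ n * b    ≈⟨ *-comm (b ^ n) b ⟩
    b * b ^ n    ∎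

  -- The geometric mean of f 0, …, f (n - 1) does not decrease when f n is adjoined.
  ∏^[1+n]≤∏^n : ∀ f n → (∀ j → j ℕ.≤ n → 0# ≤ f j) → (∀ j → j ℕ.< n → f j ≤ f n) →
    ∏ f n ^ suc n ≤ ∏ f (suc n) ^ n
  ∏^[1+n]≤∏^n f n 0≤f f≤fn = begin
    ∏ f n * ∏ f n ^ n    ≈⟨ *-comm (∏ f n) (∏ f n ^ n) ⟩
    ∏ f n ^ n * ∏ f n    ≤⟨ *-monoʳ-≤ (^-nonNeg (∏-nonNeg f n 0≤f′) n)
                              (∏≤b^n f n (0≤f n ℕₚ.≤-refl) 0≤f′ f≤fn) ⟩
    ∏ f n ^ n * f n ^ n  ≈⟨ ^-distrib-* (∏ f n) (f n) n ⟨
    (∏ f n * f n) ^ n    ∎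
    where
    0≤f′ : ∀ j → j ℕ.< n → 0# ≤ f j
    0≤f′ j j<n = 0≤f j (ℕₚ.<⇒≤ j<n)

  -- Decreasing means of a log-concave sequence.

  module LogConcave (d : ℕ) (p : ℕ → Carrier)
    (p₀≈1 : p 0 ≈ 1#)
    (0<p : ∀ i → i ℕ.≤ d → 0# < p i)
    (log-concave : ∀ i → 2 ℕ.+ i ℕ.≤ d → p i * p (2 ℕ.+ i) ≤ p (1 ℕ.+ i) * p (1 ℕ.+ i))
    where

    -- This is how Maclaurin's inequalities follow from Newton's. For consecutive terms u, v, w, the
    -- induction hypothesis v ^ k ≤ u ^ (k + 1) is multiplied by w ^ (k + 1); the (k + 1)-th power
    -- of u w ≤ v v then bounds the result, and v ^ k cancels. The base case is where `p 0 ≈ 1`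
    -- enters.
    p[1+i]^i≤p[i]^[1+i] : ∀ i → i ℕ.< d → p (suc i) ^ i ≤ p i ^ suc i
    p[1+i]^i≤p[i]^[1+i] zero    _     = ≤-reflexive (sym (trans (*-identityʳ (p 0)) p₀≈1))
    p[1+i]^i≤p[i]^[1+i] (suc k) 1+k<d = *-cancelʳ-≤ (^-pos 0<v k) (begin
      w ^ suc k * v ^ k        ≤⟨ *-monoʳ-≤ (^-nonNeg (<⇒≤ 0<w) (suc k))
                                    (p[1+i]^i≤p[i]^[1+i] k k<d) ⟩
      w ^ suc k * u ^ suc k    ≈⟨ *-comm (w ^ suc k) (u ^ suc k) ⟩
      u ^ suc k * w ^ suc k    ≈⟨ ^-distrib-* u w (suc k) ⟨
      (u * w) ^ suc k          ≤⟨ ^-mono-≤ (*-nonNeg (<⇒≤ 0<u) (<⇒≤ 0<w))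
                                    (log-concave k 1+k<d) (suc k) ⟩
      (v * v) ^ suc k          ≈⟨ ^-distrib-* v v (suc k) ⟩
      v ^ suc k * (v * v ^ k)  ≈⟨ *-assoc (v ^ suc k) v (v ^ k) ⟨
      v ^ suc k * v * v ^ k    ≈⟨ *-congʳ (*-comm (v ^ suc k) v) ⟩
      v * v ^ suc k * v ^ k    ∎)
      where
      k<d = ℕₚ.m+n≤o⇒n≤o 1 1+k<d
      u = p k
      v = p (suc k)
      w = p (suc (suc k))
      0<u = 0<p k (ℕₚ.<⇒≤ k<d)
      0<v = 0<p (suc k) k<d
      0<w = 0<p (suc (suc k)) 1+k<d

    -- Downward induction from d, with k = d - i as the measure. A lower bound 1 for p (i + 1)
    -- passes to its i-th power and from there to p i ^ (i + 1), whose exponent is positive even at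
    -- i = 0.
    1≤p : 1# ≤ p d → ∀ k i → k ℕ.+ i ≡ d → 1# ≤ p i
    1≤p 1≤p[d] zero    i ≡.refl = 1≤p[d]
    1≤p 1≤p[d] (suc k) i k+i≡d = 1≤x^[1+n]⇒1≤x (<⇒≤ (0<p i (ℕₚ.<⇒≤ i<d))) i
      (≤-trans (1≤x^n (1≤p 1≤p[d] k (suc i) (≡.trans (ℕₚ.+-suc k i) k+i≡d)) i)
               (p[1+i]^i≤p[i]^[1+i] i i<d))
      where
      i<d : i ℕ.< d
      i<d = ≡.subst (i ℕ.<_) k+i≡d (s≤s (ℕₚ.m≤n+m i k))

  -- Normalised binomials as products of linear factors, and the main contradiction.

  -- ν embeds the natural numbers and κ j is the reciprocal of d - j.
  module NormalisedBinomial (d : ℕ) (ν κ : ℕ → Carrier)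
    (ν-mono-≤ : ∀ {i j} → i ℕ.≤ j → ν i ≤ ν j)
    (0<κ : ∀ j → 0# < κ j)
    (κ-mono-≤ : ∀ {i j} → i ℕ.≤ j → κ i ≤ κ j)
    (κ-inverse : ∀ j → j ℕ.< d → (ν d - ν j) * κ j ≈ 1#)
    where

    factor : Carrier → ℕ → Carrier
    factor y j = (y - ν j) * κ j

    -- normalisedBinom y i = binom(y, i) / binom(d, i)
    normalisedBinom : Carrier → ℕ → Carrier
    normalisedBinom y = ∏ (factor y)

    factor-nonNeg : ∀ {y} j → ν j ≤ y → 0# ≤ factor y j
    factor-nonNeg j νj≤y = *-nonNeg (x≤y⇒0≤y-x νj≤y) (<⇒≤ (0<κ j))

    factor-mono-< : ∀ {y z} j → y < z → factor y j < factor z j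
    factor-mono-< j y<z = *-monoˡ-< (0<κ j) (+-monoˡ-< (- ν j) y<z)

    -- After this rewriting j survives only in the reciprocal, with coefficient y - d. Once y ≥ d,
    -- monotonicity in j is inherited from that of `κ`.
    factor-shift : ∀ y j → j ℕ.< d → factor y j ≈ (y - ν d) * κ j + 1#
    factor-shift y j j<d = begin-equality
      (y - ν j) * κ j                      ≈⟨ *-congʳ telescope ⟨
      ((y - ν d) + (ν d - ν j)) * κ j      ≈⟨ distribʳ (κ j) (y - ν d) (ν d - ν j) ⟩
      (y - ν d) * κ j + (ν d - ν j) * κ j  ≈⟨ +-congˡ (κ-inverse j j<d) ⟩
      (y - ν d) * κ j + 1#                 ∎
      where
      telescope : (y - ν d) + (ν d - ν j) ≈ y - ν j
      telescope = begin-equality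
        (y - ν d) + (ν d - ν j)      ≈⟨ +-assoc y (- ν d) (ν d - ν j) ⟩
        y + (- ν d + (ν d - ν j))    ≈⟨ +-congˡ (+-assoc (- ν d) (ν d) (- ν j)) ⟨
        y + ((- ν d + ν d) + - ν j)  ≈⟨ +-congˡ (+-congʳ (-‿inverseˡ (ν d))) ⟩
        y + (0# + - ν j)             ≈⟨ +-congˡ (+-identityˡ (- ν j)) ⟩
        y - ν j                      ∎

    factor-monoʳ-≤ : ∀ {y} → ν d ≤ y → ∀ {i j} → i ℕ.≤ j → j ℕ.< d → factor y i ≤ factor y j
    factor-monoʳ-≤ {y} νd≤y {i} {j} i≤j j<d = begin
      factor y i            ≈⟨ factor-shift y i (ℕₚ.≤-<-trans i≤j j<d) ⟩
      (y - ν d) * κ i + 1#  ≤⟨ +-monoˡ-≤ 1# (*-monoʳ-≤ (x≤y⇒0≤y-x νd≤y) (κ-mono-≤ i≤j)) ⟩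
      (y - ν d) * κ j + 1#  ≈⟨ factor-shift y j j<d ⟨
      factor y j            ∎

    1≤factor : ∀ {y} → ν d ≤ y → ∀ j → j ℕ.< d → 1# ≤ factor y j
    1≤factor {y} νd≤y j j<d = begin
      1#                 ≈⟨ κ-inverse j j<d ⟨
      (ν d - ν j) * κ j  ≤⟨ *-monoˡ-≤ (<⇒≤ (0<κ j)) (+-monoˡ-≤ (- ν j) νd≤y) ⟩
      factor y j         ∎

    -- The bound on y controls the smallest numerator y - i, hence all i + 1 of them. This is the
    -- branch on which binom(y, i + 1) determines y.
    normalisedBinom-mono-< : ∀ {y z} i → ν i ≤ y → y < z →
      normalisedBinom y (suc i) < normalisedBinom z (suc i)
    normalisedBinom-mono-< {y} {z} i νi≤y y<z = ∏-mono-< (factor y) (factor z) i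
      (λ j j≤i → factor-nonNeg j (≤-trans (ν-mono-≤ j≤i) νi≤y))
      (λ j _ → factor-mono-< j y<z)

    roots-decreasing : (x : ℕ → Carrier) →
      (∀ i → suc i ℕ.≤ d → ν i ≤ x (suc i)) →
      (∀ i → i ℕ.≤ d → 0# < normalisedBinom (x i) i) →
      (∀ i → 2 ℕ.+ i ℕ.≤ d →
        normalisedBinom (x i) i * normalisedBinom (x (2 ℕ.+ i)) (2 ℕ.+ i) ≤
        normalisedBinom (x (1 ℕ.+ i)) (1 ℕ.+ i) * normalisedBinom (x (1 ℕ.+ i)) (1 ℕ.+ i)) →
      ν d ≤ x d →
      ∀ i → suc i ℕ.< d → x (2 ℕ.+ i) ≤ x (1 ℕ.+ i)
    roots-decreasing x ν≤x 0<p log-concave νd≤xd i 1+i<d = ≮⇒≥ λ x<y → <-irrefl (begin-strict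
      -- Every term is a geometric mean raised to the common power (1 + i)(2 + i): the products have
      -- 1 + i or 2 + i factors, and the other number is the exponent.
      p (suc i) ^ (2 ℕ.+ i)                    <⟨ ^-mono-< (<⇒≤ (0<p (suc i) (ℕₚ.<⇒≤ 1+i<d)))
                                                    (normalisedBinom-mono-< i (ν≤x i (ℕₚ.<⇒≤ 1+i<d)) x<y)
                                                    (suc i) ⟩
      normalisedBinom y (suc i) ^ (2 ℕ.+ i)    ≤⟨ ∏^[1+n]≤∏^n (factor y) (suc i)
                                                    (λ j j≤1+i → ≤-trans 0≤1
                                                      (1≤factor νd≤y j (ℕₚ.≤-<-trans j≤1+i 1+i<d)))
                                                    (λ j j<1+i → factor-monoʳ-≤ νd≤y (ℕₚ.<⇒≤ j<1+i) 1+i<d) ⟩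
      p (2 ℕ.+ i) ^ suc i                      ≤⟨ p[1+i]^i≤p[i]^[1+i] (suc i) 1+i<d ⟩
      p (suc i) ^ (2 ℕ.+ i)                    ∎)
      where
      p : ℕ → Carrier
      p k = normalisedBinom (x k) k

      open LogConcave d p refl 0<p log-concave

      y : Carrier
      y = x (2 ℕ.+ i)

      1≤p[2+i] : 1# ≤ p (2 ℕ.+ i)
      1≤p[2+i] = 1≤p (1≤∏ (factor (x d)) d (1≤factor νd≤xd)) (d ∸ (2 ℕ.+ i)) (2 ℕ.+ i)
        (ℕₚ.m∸n+n≡m 1+i<d)

      νd≤y : ν d ≤ y
      -- At y = d each factor is 1, so an argument below d would push p (2 + i) below 1.
      νd≤y = ≮⇒≥ λ y<νd → <-irrefl (begin-strict
        1#                            ≤⟨ 1≤p[2+i] ⟩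
        p (2 ℕ.+ i)                   <⟨ normalisedBinom-mono-< (suc i) (ν≤x (suc i) 1+i<d) y<νd ⟩
        normalisedBinom (ν d) (2 ℕ.+ i) ≈⟨ ∏-≈1 (factor (ν d)) (2 ℕ.+ i)
                                            (λ j j<2+i → κ-inverse j (ℕₚ.≤-trans j<2+i 1+i<d)) ⟩
        1#                            ∎)

-- The Cauchy reals as an ordered commutative ring.

module RealOrder where

  open import Data.Integer.Base using (+_)
  open import Data.Rational.Base hiding (_≃_)
  open import Data.Rational.Properties as ℚₚ using (module ≤-Reasoning)
  open import Data.Rational.Solver using (module +-*-Solver)
  open ≤-Reasoning

  private
    ⅓ : ℚ
    ⅓ = + 1 / 3

  *-pos : ∀ {p q} → 0ℚ < p → 0ℚ < q → 0ℚ < p * q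
  *-pos {p} {q} 0<p 0<q = ℚₚ.positive⁻¹ (p * q)
    {{ℚₚ.pos*pos⇒pos p {{positive 0<p}} q {{positive 0<q}}}}

  *-nonNeg : ∀ {p q} → 0ℚ ≤ p → 0ℚ ≤ q → 0ℚ ≤ p * q
  *-nonNeg {p} {q} 0≤p 0≤q = ℚₚ.nonNegative⁻¹ (p * q)
    {{ℚₚ.nonNeg*nonNeg⇒nonNeg p {{nonNegative 0≤p}} q {{nonNegative 0≤q}}}}

  0<½ε : ∀ {ε} → 0ℚ < ε → 0ℚ < ½ * ε
  0<½ε = *-pos (ℚₚ.positive⁻¹ ½)

  p≤p+q : ∀ p {q} → 0ℚ ≤ q → p ≤ p + q
  p≤p+q p {q} 0≤q = begin
    p       ≡⟨ ℚₚ.+-identityʳ p ⟨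
    p + 0ℚ  ≤⟨ ℚₚ.+-monoʳ-≤ p 0≤q ⟩
    p + q   ∎

  p≤∣p∣ : ∀ p → p ≤ ∣ p ∣
  p≤∣p∣ p with ℚₚ.≤-total 0ℚ p
  ... | inj₁ 0≤p = ℚₚ.≤-reflexive (≡.sym (ℚₚ.0≤p⇒∣p∣≡p 0≤p))
  ... | inj₂ p≤0 = ℚₚ.≤-trans p≤0 (ℚₚ.0≤∣p∣ p)

  ∣p-q∣≤ε⇒p≤q+ε : ∀ p q {ε} → ∣ p - q ∣ ≤ ε → p ≤ q + ε
  ∣p-q∣≤ε⇒p≤q+ε p q {ε} ∣p-q∣≤ε = begin
    p              ≡⟨ solve 2 (λ p q → p := q :+ (p :- q)) ≡.refl p q ⟩
    q + (p - q)    ≤⟨ ℚₚ.+-monoʳ-≤ q (ℚₚ.≤-trans (p≤∣p∣ (p - q)) ∣p-q∣≤ε) ⟩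
    q + ε          ∎
    where open +-*-Solver

  ∣p-q∣≡∣q-p∣ : ∀ p q → ∣ p - q ∣ ≡ ∣ q - p ∣
  ∣p-q∣≡∣q-p∣ p q = ≡.trans (≡.sym (ℚₚ.∣-p∣≡∣p∣ (p - q)))
    (cong ∣_∣ (solve 2 (λ p q → :- (p :- q) := q :- p) ≡.refl p q))
    where open +-*-Solver

  p≤q+ε⇒∣p-q∣≤ε : ∀ p q {ε} → p ≤ q + ε → q ≤ p + ε → ∣ p - q ∣ ≤ ε
  p≤q+ε⇒∣p-q∣≤ε p q {ε} p≤q+ε q≤p+ε with ℚₚ.∣p∣≡p∨∣p∣≡-p (p - q)
  ... | inj₁ ∣∣≡ = begin
    ∣ p - q ∣  ≡⟨ ∣∣≡ ⟩
    p - q      ≤⟨ ℚₚ.+-monoˡ-≤ (- q) p≤q+ε ⟩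
    q + ε - q  ≡⟨ solve 2 (λ q ε → q :+ ε :- q := ε) ≡.refl q ε ⟩
    ε          ∎
    where open +-*-Solver
  ... | inj₂ ∣∣≡ = begin
    ∣ p - q ∣  ≡⟨ ∣∣≡ ⟩
    - (p - q)  ≡⟨ solve 2 (λ p q → :- (p :- q) := q :- p) ≡.refl p q ⟩
    q - p      ≤⟨ ℚₚ.+-monoˡ-≤ (- p) q≤p+ε ⟩
    p + ε - p  ≡⟨ solve 2 (λ p ε → p :+ ε :- p := ε) ≡.refl p ε ⟩
    ε          ∎
    where open +-*-Solver

  divide : ∀ {s ε} → 0ℚ < s → 0ℚ < ε → ∃[ δ ] (0ℚ < δ × δ * s ≡ ε)
  divide {s} {ε} 0<s 0<ε = ε * 1/ s ,
    *-pos 0<ε (ℚₚ.positive⁻¹ (1/ s) {{ℚₚ.1/pos⇒pos s}}) ,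
    ≡.trans (ℚₚ.*-assoc ε (1/ s) s)
      (≡.trans (cong (ε *_) (ℚₚ.*-inverseˡ s)) (ℚₚ.*-identityʳ ε))
    where
    instance
      s-pos : Positive s
      s-pos = positive 0<s
      s≢0 : NonZero s
      s≢0 = ℚₚ.pos⇒nonZero s

  Eventually : (ℕ → Set) → Set
  Eventually P = ∃[ N ] (∀ n → N ℕ.≤ n → P n)

  map : ∀ {P Q : ℕ → Set} → (∀ n → P n → Q n) → Eventually P → Eventually Q
  map f (N , p) = N , λ n N≤n → f n (p n N≤n)

  zip : ∀ {P Q R : ℕ → Set} → (∀ n → P n → Q n → R n) →
    Eventually P → Eventually Q → Eventually R
  zip f (M , p) (N , q) = M ℕ.⊔ N , λ n M⊔N≤n →
    f n (p n (ℕₚ.m⊔n≤o⇒m≤o M N M⊔N≤n)) (q n (ℕₚ.m⊔n≤o⇒n≤o M N M⊔N≤n))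

  eventually-bounded : ∀ x → ∃[ B ] (0ℚ < B × Eventually (λ n → ∣ seq x n ∣ ≤ B))
  eventually-bounded x with cauchy x 1ℚ (ℚₚ.positive⁻¹ 1ℚ)
  ... | N , close = ∣ seq x N ∣ + 1ℚ ,
    ℚₚ.+-mono-≤-< (ℚₚ.0≤∣p∣ (seq x N)) (ℚₚ.positive⁻¹ 1ℚ) , N , λ n N≤n → begin
      ∣ seq x n ∣                           ≡⟨ cong ∣_∣ (rearrange (seq x n) (seq x N)) ⟩
      ∣ seq x N + (seq x n - seq x N) ∣     ≤⟨ ℚₚ.∣p+q∣≤∣p∣+∣q∣ (seq x N) (seq x n - seq x N) ⟩
      ∣ seq x N ∣ + ∣ seq x n - seq x N ∣   ≤⟨ ℚₚ.+-monoʳ-≤ ∣ seq x N ∣ (close n N N≤n ℕₚ.≤-refl) ⟩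
      ∣ seq x N ∣ + 1ℚ                      ∎
    where
    rearrange : ∀ p q → p ≡ q + (p - q)
    rearrange = solve 2 (λ p q → p := q :+ (p :- q)) ≡.refl
      where open +-*-Solver

  pointwise-≤ : ∀ x y → (∀ n → seq x n ≤ seq y n) → x ≤ℝ y
  pointwise-≤ x y x≤y ε 0<ε =
    0 , λ n _ → ℚₚ.≤-trans (x≤y n) (p≤p+q (seq y n) (ℚₚ.<⇒≤ 0<ε))

  ≤ℝ-trans : ∀ x y z → x ≤ℝ y → y ≤ℝ z → x ≤ℝ z
  ≤ℝ-trans x y z x≤y y≤z ε 0<ε =
    zip (λ n → step (seq x n) (seq y n) (seq z n)) (x≤y (½ * ε) (0<½ε 0<ε)) (y≤z (½ * ε) (0<½ε 0<ε))
    where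
    step : ∀ p q r → p ≤ q + ½ * ε → q ≤ r + ½ * ε → p ≤ r + ε
    step p q r p≤q q≤r = begin
      p                    ≤⟨ p≤q ⟩
      q + ½ * ε            ≤⟨ ℚₚ.+-monoˡ-≤ (½ * ε) q≤r ⟩
      r + ½ * ε + ½ * ε    ≡⟨ solve 2 (λ r ε → r :+ con ½ :* ε :+ con ½ :* ε := r :+ ε) ≡.refl r ε ⟩
      r + ε                ∎
      where open +-*-Solver

  ≃⇒≤ℝ : ∀ x y → x ≃ y → x ≤ℝ y
  ≃⇒≤ℝ x y x≃y ε 0<ε = map (λ n → ∣p-q∣≤ε⇒p≤q+ε (seq x n) (seq y n)) (x≃y ε 0<ε)

  ≤ℝ-antisym : ∀ x y → x ≤ℝ y → y ≤ℝ x → x ≃ y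
  ≤ℝ-antisym x y x≤y y≤x ε 0<ε =
    zip (λ n → p≤q+ε⇒∣p-q∣≤ε (seq x n) (seq y n)) (x≤y ε 0<ε) (y≤x ε 0<ε)

  -- The ring laws other than the congruences come from this: they hold exactly in ℚ at each index,
  -- so no estimate is involved.
  pointwise-≃ : ∀ x y → (∀ n → seq x n ≡ seq y n) → x ≃ y
  pointwise-≃ x y x≡y = ≤ℝ-antisym x y
    (pointwise-≤ x y λ n → ℚₚ.≤-reflexive (x≡y n))
    (pointwise-≤ y x λ n → ℚₚ.≤-reflexive (≡.sym (x≡y n)))

  ≃-sym : ∀ x y → x ≃ y → y ≃ x
  ≃-sym x y x≃y ε 0<ε =
    map (λ n → subst (_≤ ε) (∣p-q∣≡∣q-p∣ (seq x n) (seq y n))) (x≃y ε 0<ε)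

  ≃-trans : ∀ x y z → x ≃ y → y ≃ z → x ≃ z
  ≃-trans x y z x≃y y≃z = ≤ℝ-antisym x z
    (≤ℝ-trans x y z (≃⇒≤ℝ x y x≃y) (≃⇒≤ℝ y z y≃z))
    (≤ℝ-trans z y x (≃⇒≤ℝ z y (≃-sym y z y≃z)) (≃⇒≤ℝ y x (≃-sym x y x≃y)))

  ≃-isEquivalence : IsEquivalence _≃_
  ≃-isEquivalence = record
    { refl  = λ {x} → pointwise-≃ x x λ _ → ≡.refl
    ; sym   = λ {x y} → ≃-sym x y
    ; trans = λ {x y z} → ≃-trans x y z
    }

  <ℝ⇒≤ℝ : ∀ x y → x <ℝ y → x ≤ℝ y
  <ℝ⇒≤ℝ x y (δ , 0<δ , x<y) ε 0<ε = map (λ n x+δ≤y → begin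
    seq x n      ≤⟨ p≤p+q (seq x n) (ℚₚ.<⇒≤ 0<δ) ⟩
    seq x n + δ  ≤⟨ x+δ≤y ⟩
    seq y n      ≤⟨ p≤p+q (seq y n) (ℚₚ.<⇒≤ 0<ε) ⟩
    seq y n + ε  ∎) x<y

  <ℝ-irrefl : ∀ x → ¬ (x <ℝ x)
  <ℝ-irrefl x (ε , 0<ε , N , x<x) = ℚₚ.<-irrefl ≡.refl (begin-strict
    seq x N       ≡⟨ ℚₚ.+-identityʳ (seq x N) ⟨
    seq x N + 0ℚ  <⟨ ℚₚ.+-monoʳ-< (seq x N) 0<ε ⟩
    seq x N + ε   ≤⟨ x<x N ℕₚ.≤-refl ⟩
    seq x N       ∎)

  -- Half of the gap absorbs the tolerance allowed by `_≤ℝ_`; the other half remains as the new gap.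
  <ℝ-≤ℝ-trans : ∀ x y z → x <ℝ y → y ≤ℝ z → x <ℝ z
  <ℝ-≤ℝ-trans x y z (ε , 0<ε , x<y) y≤z =
    ½ * ε , 0<½ε 0<ε , zip (λ n → step (seq x n) (seq y n) (seq z n)) x<y (y≤z (½ * ε) (0<½ε 0<ε))
    where
    step : ∀ p q r → p + ε ≤ q → q ≤ r + ½ * ε → p + ½ * ε ≤ r
    step p q r p<q q≤r = begin
      p + ½ * ε              ≡⟨ solve 2 (λ p ε → p :+ con ½ :* ε := p :+ ε :- con ½ :* ε) ≡.refl p ε ⟩
      p + ε - ½ * ε          ≤⟨ ℚₚ.+-monoˡ-≤ (- (½ * ε)) (ℚₚ.≤-trans p<q q≤r) ⟩
      r + ½ * ε - ½ * ε      ≡⟨ solve 2 (λ r δ → r :+ δ :- δ := r) ≡.refl r (½ * ε) ⟩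
      r                      ∎
      where open +-*-Solver

  ≤ℝ-<ℝ-trans : ∀ x y z → x ≤ℝ y → y <ℝ z → x <ℝ z
  ≤ℝ-<ℝ-trans x y z x≤y (ε , 0<ε , y<z) =
    ½ * ε , 0<½ε 0<ε , zip (λ n → step (seq x n) (seq y n) (seq z n)) (x≤y (½ * ε) (0<½ε 0<ε)) y<z
    where
    step : ∀ p q r → p ≤ q + ½ * ε → q + ε ≤ r → p + ½ * ε ≤ r
    step p q r p≤q q<r = begin
      p + ½ * ε            ≤⟨ ℚₚ.+-monoˡ-≤ (½ * ε) p≤q ⟩
      q + ½ * ε + ½ * ε    ≡⟨ solve 2 (λ q ε → q :+ con ½ :* ε :+ con ½ :* ε := q :+ ε) ≡.refl q ε ⟩
      q + ε                ≤⟨ q<r ⟩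
      r                    ∎
      where open +-*-Solver

  -- Compare one late term of the Cauchy sequence y - x, of modulus ε / 3, with 2 ε / 3.
  ≮ℝ⇒≥ℝ : ∀ x y → ¬ (x <ℝ y) → y ≤ℝ x
  ≮ℝ⇒≥ℝ x y x≮y ε 0<ε with cauchy (y -ℝ x) (⅓ * ε) (*-pos (ℚₚ.positive⁻¹ ⅓) 0<ε)
  ... | N , close with (seq y N - seq x N) ℚₚ.≤? (⅓ * ε + ⅓ * ε)
  ...   | yes z≤2τ = N , λ n N≤n → begin
    seq y n                              ≡⟨ rearrange (seq x n) (seq y n) ⟩
    seq x n + (seq y n - seq x n)        ≤⟨ ℚₚ.+-monoʳ-≤ (seq x n)
                                              (∣p-q∣≤ε⇒p≤q+ε _ _ (close n N N≤n ℕₚ.≤-refl)) ⟩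
    seq x n + (seq y N - seq x N + ⅓ * ε)
      ≤⟨ ℚₚ.+-monoʳ-≤ (seq x n) (ℚₚ.+-monoˡ-≤ (⅓ * ε) z≤2τ) ⟩
    seq x n + (⅓ * ε + ⅓ * ε + ⅓ * ε)    ≡⟨ cong (λ δ → seq x n + δ) (thirds ε) ⟩
    seq x n + ε                          ∎
    where
    open +-*-Solver
    rearrange : ∀ p q → q ≡ p + (q - p)
    rearrange = solve 2 (λ p q → q := p :+ (q :- p)) ≡.refl
    thirds : ∀ ε → ⅓ * ε + ⅓ * ε + ⅓ * ε ≡ ε
    thirds = solve 1 (λ ε → con ⅓ :* ε :+ con ⅓ :* ε :+ con ⅓ :* ε := ε) ≡.refl
  ...   | no  z≰2τ = contradiction (⅓ * ε , *-pos (ℚₚ.positive⁻¹ ⅓) 0<ε , N , gap) x≮y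
    where
    open +-*-Solver
    gap : ∀ n → N ℕ.≤ n → seq x n + ⅓ * ε ≤ seq y n
    gap n N≤n = begin
      seq x n + ⅓ * ε                        ≡⟨ solve 2 (λ p δ → p :+ δ := p :+ (δ :+ δ :- δ))
                                                  ≡.refl (seq x n) (⅓ * ε) ⟩
      seq x n + (⅓ * ε + ⅓ * ε - ⅓ * ε)
        ≤⟨ ℚₚ.+-monoʳ-≤ (seq x n) (ℚₚ.+-monoˡ-≤ (- (⅓ * ε)) (ℚₚ.≤-trans (ℚₚ.<⇒≤ (ℚₚ.≰⇒> z≰2τ))
             (∣p-q∣≤ε⇒p≤q+ε _ _ (close N n ℕₚ.≤-refl N≤n)))) ⟩
      seq x n + (seq y n - seq x n + ⅓ * ε - ⅓ * ε)
        ≡⟨ solve 3 (λ p q δ → p :+ (q :- p :+ δ :- δ) := q) ≡.refl (seq x n) (seq y n) (⅓ * ε) ⟩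
      seq y n                                ∎

  +-swap : ∀ p q r → p + q + r ≡ p + r + q
  +-swap = solve 3 (λ p q r → p :+ q :+ r := p :+ r :+ q) ≡.refl
    where open +-*-Solver

  +ℝ-monoˡ-≤ : ∀ z x y → x ≤ℝ y → x +ℝ z ≤ℝ y +ℝ z
  +ℝ-monoˡ-≤ z x y x≤y ε 0<ε = map (λ n x≤y+ε → begin
    seq x n + seq z n      ≤⟨ ℚₚ.+-monoˡ-≤ (seq z n) x≤y+ε ⟩
    seq y n + ε + seq z n  ≡⟨ +-swap (seq y n) ε (seq z n) ⟩
    seq y n + seq z n + ε  ∎) (x≤y ε 0<ε)

  +ℝ-monoˡ-< : ∀ z x y → x <ℝ y → x +ℝ z <ℝ y +ℝ z
  +ℝ-monoˡ-< z x y (ε , 0<ε , x<y) = ε , 0<ε , map (λ n x+ε≤y → begin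
    seq x n + seq z n + ε  ≡⟨ +-swap (seq x n) (seq z n) ε ⟩
    seq x n + ε + seq z n  ≤⟨ ℚₚ.+-monoˡ-≤ (seq z n) x+ε≤y ⟩
    seq y n + seq z n      ∎) x<y

  -- The gaps multiply: from r ≥ δ and q - p ≥ ε follows (q - p) r ≥ ε δ, whatever the signs of p
  -- and q.
  *ℝ-monoˡ-< : ∀ x y z → ⟦ 0 ⟧ <ℝ z → x <ℝ y → x *ℝ z <ℝ y *ℝ z
  *ℝ-monoˡ-< x y z (δ , 0<δ , 0<z) (ε , 0<ε , x<y) =
    ε * δ , *-pos 0<ε 0<δ , zip (λ n → step (seq x n) (seq y n) (seq z n)) 0<z x<y
    where
    step : ∀ p q r → 0ℚ + δ ≤ r → p + ε ≤ q → p * r + ε * δ ≤ q * r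
    step p q r 0<r p<q = begin
      p * r + ε * δ  ≤⟨ ℚₚ.+-monoʳ-≤ (p * r)
                          (ℚₚ.*-monoˡ-≤-nonNeg ε {{nonNegative (ℚₚ.<⇒≤ 0<ε)}} δ≤r) ⟩
      p * r + ε * r  ≡⟨ ℚₚ.*-distribʳ-+ r p ε ⟨
      (p + ε) * r    ≤⟨ ℚₚ.*-monoʳ-≤-nonNeg r
                          {{nonNegative (ℚₚ.≤-trans (ℚₚ.<⇒≤ 0<δ) δ≤r)}} p<q ⟩
      q * r          ∎
      where
      δ≤r : δ ≤ r
      δ≤r = ℚₚ.≤-trans (ℚₚ.≤-reflexive (≡.sym (ℚₚ.+-identityˡ δ))) 0<r

  min-pos : ∀ {p q} → 0ℚ < p → 0ℚ < q → ∃[ r ] (0ℚ < r × r ≤ p × r ≤ q)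
  min-pos {p} {q} 0<p 0<q with ℚₚ.≤-total p q
  ... | inj₁ p≤q = p , 0<p , ℚₚ.≤-refl , p≤q
  ... | inj₂ q≤p = q , 0<q , q≤p , ℚₚ.≤-refl

  -- (q + η - p) (r + η) ≥ 0 is expanded to bound p r - q r.
  *-mono-≤-approx : ∀ p q r {η δ B} → 0ℚ < η → 0ℚ < B → η ≤ δ → η ≤ 1ℚ →
    ∣ q - p + r + 1ℚ ∣ ≤ B → 0ℚ ≤ r + η → p ≤ q + η → p * r ≤ q * r + δ * B
  *-mono-≤-approx p q r {η} {δ} {B} 0<η 0<B η≤δ η≤1 b 0≤r+η p≤q+η = begin
    p * r                          ≤⟨ p≤p+q (p * r) (*-nonNeg 0≤q+η-p 0≤r+η) ⟩
    p * r + (q + η - p) * (r + η)  ≡⟨ expand p q r η ⟩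
    q * r + η * (q - p + r + η)
      ≤⟨ ℚₚ.+-monoʳ-≤ (q * r) (ℚₚ.*-monoˡ-≤-nonNeg η {{nonNegative (ℚₚ.<⇒≤ 0<η)}}
           (ℚₚ.≤-trans (ℚₚ.+-monoʳ-≤ (q - p + r) η≤1)
             (ℚₚ.≤-trans (p≤∣p∣ (q - p + r + 1ℚ)) b))) ⟩
    q * r + η * B
      ≤⟨ ℚₚ.+-monoʳ-≤ (q * r) (ℚₚ.*-monoʳ-≤-nonNeg B {{nonNegative (ℚₚ.<⇒≤ 0<B)}} η≤δ) ⟩
    q * r + δ * B                  ∎
    where
    expand : ∀ p q r η → p * r + (q + η - p) * (r + η) ≡ q * r + η * (q - p + r + η)
    expand = solve 4 (λ p q r η → p :* r :+ (q :+ η :- p) :* (r :+ η)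
                               := q :* r :+ η :* (q :- p :+ r :+ η)) ≡.refl
      where open +-*-Solver

    0≤q+η-p : 0ℚ ≤ q + η - p
    0≤q+η-p = begin
      0ℚ         ≡⟨ ℚₚ.+-inverseʳ p ⟨
      p - p      ≤⟨ ℚₚ.+-monoˡ-≤ (- p) p≤q+η ⟩
      q + η - p  ∎

  -- Monotonicity in ℚ cannot be applied term by term, since the terms of z may be slightly negative
  -- and those of x may slightly exceed those of y. Both errors are held to one η and the resulting
  -- error in the product is estimated.
  *ℝ-monoˡ-≤ : ∀ x y z → ⟦ 0 ⟧ ≤ℝ z → x ≤ℝ y → x *ℝ z ≤ℝ y *ℝ z
  *ℝ-monoˡ-≤ x y z 0≤z x≤y ε 0<ε =
    -- `B` bounds y - x + z + 1, which dominates the cofactor of η in the expanded product as soon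
    -- as η ≤ 1. With η ≤ δ the total error is at most δ B = ε.
    let B , 0<B , bounded = eventually-bounded (y -ℝ x +ℝ z +ℝ ⟦ 1 ⟧)
        δ , 0<δ , δB≡ε = divide 0<B 0<ε
        η , 0<η , η≤δ , η≤1 = min-pos 0<δ (ℚₚ.positive⁻¹ 1ℚ)
    in zip (λ n b (0≤z+η , x≤y+η) → subst (λ e → seq x n * seq z n ≤ seq y n * seq z n + e) δB≡ε
             (*-mono-≤-approx (seq x n) (seq y n) (seq z n) 0<η 0<B η≤δ η≤1 b 0≤z+η x≤y+η))
           bounded (zip (λ _ → _,_) (0≤z η 0<η) (x≤y η 0<η))

  +ℝ-cong : ∀ x y u v → x ≃ y → u ≃ v → x +ℝ u ≃ y +ℝ v
  +ℝ-cong x y u v x≃y u≃v ε 0<ε =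
    zip (λ n → step (seq x n) (seq y n) (seq u n) (seq v n))
      (x≃y (½ * ε) (0<½ε 0<ε)) (u≃v (½ * ε) (0<½ε 0<ε))
    where
    open +-*-Solver
    step : ∀ p q r s → ∣ p - q ∣ ≤ ½ * ε → ∣ r - s ∣ ≤ ½ * ε → ∣ (p + r) - (q + s) ∣ ≤ ε
    step p q r s pq rs = begin
      ∣ (p + r) - (q + s) ∣
        ≡⟨ cong ∣_∣ (solve 4 (λ p q r s → (p :+ r) :- (q :+ s) := (p :- q) :+ (r :- s)) ≡.refl p q r s) ⟩
      ∣ (p - q) + (r - s) ∣    ≤⟨ ℚₚ.∣p+q∣≤∣p∣+∣q∣ (p - q) (r - s) ⟩
      ∣ p - q ∣ + ∣ r - s ∣    ≤⟨ ℚₚ.+-mono-≤ pq rs ⟩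
      ½ * ε + ½ * ε            ≡⟨ solve 1 (λ ε → con ½ :* ε :+ con ½ :* ε := ε) ≡.refl ε ⟩
      ε                        ∎

  -ℝ-cong : ∀ x y → x ≃ y → -ℝ x ≃ -ℝ y
  -ℝ-cong x y x≃y ε 0<ε = map (λ n → subst (_≤ ε) (step (seq x n) (seq y n))) (x≃y ε 0<ε)
    where
    open +-*-Solver
    step : ∀ p q → ∣ p - q ∣ ≡ ∣ - p - - q ∣
    step p q = ≡.trans (∣p-q∣≡∣q-p∣ p q)
      (cong ∣_∣ (solve 2 (λ p q → q :- p := :- p :- :- q) ≡.refl p q))

  *ℝ-congʳ : ∀ z x y → x ≃ y → x *ℝ z ≃ y *ℝ z
  *ℝ-congʳ z x y x≃y ε 0<ε =
    let B , 0<B , bounded = eventually-bounded z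
        δ , 0<δ , δB≡ε = divide 0<B 0<ε
    in zip (λ n x-y z≤B → subst (∣ seq x n * seq z n - seq y n * seq z n ∣ ≤_) δB≡ε
             (step (seq x n) (seq y n) (seq z n) 0<δ x-y z≤B))
           (x≃y δ 0<δ) bounded
    where
    step : ∀ p q r {δ B} → 0ℚ < δ → ∣ p - q ∣ ≤ δ → ∣ r ∣ ≤ B → ∣ p * r - q * r ∣ ≤ δ * B
    step p q r {δ} {B} 0<δ pq rB = begin
      ∣ p * r - q * r ∣
        ≡⟨ cong ∣_∣ (solve 3 (λ p q r → p :* r :- q :* r := (p :- q) :* r) ≡.refl p q r) ⟩
      ∣ (p - q) * r ∣    ≡⟨ ℚₚ.∣p*q∣≡∣p∣*∣q∣ (p - q) r ⟩
      ∣ p - q ∣ * ∣ r ∣  ≤⟨ ℚₚ.*-monoʳ-≤-nonNeg ∣ r ∣ {{ℚₚ.∣-∣-nonNeg r}} pq ⟩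
      δ * ∣ r ∣          ≤⟨ ℚₚ.*-monoˡ-≤-nonNeg δ {{nonNegative (ℚₚ.<⇒≤ 0<δ)}} rB ⟩
      δ * B              ∎
      where open +-*-Solver

  *ℝ-comm : ∀ x y → x *ℝ y ≃ y *ℝ x
  *ℝ-comm x y = pointwise-≃ (x *ℝ y) (y *ℝ x) λ n → ℚₚ.*-comm (seq x n) (seq y n)

  *ℝ-cong : ∀ x y u v → x ≃ y → u ≃ v → x *ℝ u ≃ y *ℝ v
  *ℝ-cong x y u v x≃y u≃v =
    ≃-trans (x *ℝ u) (y *ℝ u) (y *ℝ v) (*ℝ-congʳ u x y x≃y)
      (≃-trans (y *ℝ u) (u *ℝ y) (y *ℝ v) (*ℝ-comm y u)
        (≃-trans (u *ℝ y) (v *ℝ y) (y *ℝ v) (*ℝ-congʳ y u v u≃v) (*ℝ-comm v y)))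

  ℝ-isCommutativeRing : IsCommutativeRing _≃_ _+ℝ_ _*ℝ_ -ℝ_ ⟦ 0 ⟧ ⟦ 1 ⟧
  ℝ-isCommutativeRing = record
    { isRing = record
      { +-isAbelianGroup = record
        { isGroup = record
          { isMonoid = record
            { isSemigroup = record
              { isMagma = record
                { isEquivalence = ≃-isEquivalence
                ; ∙-cong        = λ {x y u v} → +ℝ-cong x y u v
                }
              ; assoc = λ x y z → pointwise-≃ (x +ℝ y +ℝ z) (x +ℝ (y +ℝ z))
                  λ n → ℚₚ.+-assoc (seq x n) (seq y n) (seq z n)
              }
            ; identity =
                (λ x → pointwise-≃ (⟦ 0 ⟧ +ℝ x) x λ n → ℚₚ.+-identityˡ (seq x n)) ,
                (λ x → pointwise-≃ (x +ℝ ⟦ 0 ⟧) x λ n → ℚₚ.+-identityʳ (seq x n))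
            }
          ; inverse =
              (λ x → pointwise-≃ (-ℝ x +ℝ x) ⟦ 0 ⟧ λ n → ℚₚ.+-inverseˡ (seq x n)) ,
              (λ x → pointwise-≃ (x -ℝ x) ⟦ 0 ⟧ λ n → ℚₚ.+-inverseʳ (seq x n))
          ; ⁻¹-cong = λ {x y} → -ℝ-cong x y
          }
        ; comm = λ x y → pointwise-≃ (x +ℝ y) (y +ℝ x) λ n → ℚₚ.+-comm (seq x n) (seq y n)
        }
      ; *-cong = λ {x y u v} → *ℝ-cong x y u v
      ; *-assoc = λ x y z → pointwise-≃ (x *ℝ y *ℝ z) (x *ℝ (y *ℝ z))
          λ n → ℚₚ.*-assoc (seq x n) (seq y n) (seq z n)
      ; *-identity =
          (λ x → pointwise-≃ (⟦ 1 ⟧ *ℝ x) x λ n → ℚₚ.*-identityˡ (seq x n)) ,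
          (λ x → pointwise-≃ (x *ℝ ⟦ 1 ⟧) x λ n → ℚₚ.*-identityʳ (seq x n))
      ; distrib =
          (λ x y z → pointwise-≃ (x *ℝ (y +ℝ z)) (x *ℝ y +ℝ x *ℝ z)
            λ n → ℚₚ.*-distribˡ-+ (seq x n) (seq y n) (seq z n)) ,
          (λ x y z → pointwise-≃ ((y +ℝ z) *ℝ x) (y *ℝ x +ℝ z *ℝ x)
            λ n → ℚₚ.*-distribʳ-+ (seq x n) (seq y n) (seq z n))
      }
    ; *-comm = *ℝ-comm
    }

  fromℚ-mono-< : ∀ {p q} → p < q → fromℚ p <ℝ fromℚ q
  fromℚ-mono-< {p} {q} p<q = q - p , 0<q-p , 0 , λ _ _ →
    ℚₚ.≤-reflexive (solve 2 (λ p q → p :+ (q :- p) := q) ≡.refl p q)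
    where
    open +-*-Solver
    0<q-p : 0ℚ < q - p
    0<q-p = begin-strict
      0ℚ     ≡⟨ ℚₚ.+-inverseʳ p ⟨
      p - p  <⟨ ℚₚ.+-monoˡ-< (- p) p<q ⟩
      q - p  ∎

  ℝ-orderedCommutativeRing : OrderedCommutativeRing 0ℓ 0ℓ 0ℓ 0ℓ
  ℝ-orderedCommutativeRing = record
    { commutativeRing = record { isCommutativeRing = ℝ-isCommutativeRing }
    ; _≤_          = _≤ℝ_
    ; _<_          = _<ℝ_
    ; ≤-isPreorder = record
      { isEquivalence = ≃-isEquivalence
      ; reflexive     = λ {x y} → ≃⇒≤ℝ x y
      ; trans         = λ {x y z} → ≤ℝ-trans x y z
      }
    ; <⇒≤       = λ {x y} → <ℝ⇒≤ℝ x y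
    ; <-irrefl  = λ {x} → <ℝ-irrefl x
    ; <-≤-trans = λ {x y z} → <ℝ-≤ℝ-trans x y z
    ; ≤-<-trans = λ {x y z} → ≤ℝ-<ℝ-trans x y z
    ; ≮⇒≥       = λ {x y} → ≮ℝ⇒≥ℝ x y
    ; 0<1       = fromℚ-mono-< (ℚₚ.positive⁻¹ 1ℚ)
    ; +-monoˡ-≤ = λ z {x y} → +ℝ-monoˡ-≤ z x y
    ; +-monoˡ-< = λ z {x y} → +ℝ-monoˡ-< z x y
    ; *-monoˡ-≤ = λ {x y z} → *ℝ-monoˡ-≤ x y z
    ; *-monoˡ-< = λ {x y z} → *ℝ-monoˡ-< x y z
    }

open import Data.Fin.Base using (Fin; zero; suc; toℕ; fromℕ<)
import Data.Fin.Properties as Finₚ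
open import Data.Nat.Base using (_≤_; _<_)

-- Rational identities between factorials, binomial coefficients and reciprocals.

module RationalConstants where
  open import Data.Integer.Base as ℤ using (+_)
  import Data.Integer.Properties as ℤₚ
  open import Data.Nat.Base using (_!)
  open import Data.Nat.Properties using (_!≢0)
  import Data.Nat.DivMod as ℕ using (m/n*n≡m)
  open import Data.Nat.Combinatorics using (_C_; nCk≡n!/k![n-k]!; k![n∸k]!∣n!; [n-k]*[n-k-1]!≡[n-k]!)
  open import Data.Rational.Base hiding (_≃_; _≤_; _<_)
  import Data.Rational.Base as ℚ
  import Data.Rational.Properties as ℚₚ
  open import Data.Rational.Solver using (module +-*-Solver)
  open import Algebra.Properties.CommutativeSemigroup
    (CommutativeMonoid.commutativeSemigroup ℚₚ.*-1-commutativeMonoid) using (interchange; x∙yz≈y∙xz)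
  open import Data.Rational.Unnormalised.Base as ℚᵘ using (mkℚᵘ; *≡*; *≤*)
  import Data.Rational.Unnormalised.Properties as ℚᵘₚ
  import Data.Nat.Tactic.RingSolver as ℕSolver

  -- A fraction in ℚ is reduced by a gcd, which is stuck on variables. Identities between constants
  -- are therefore checked by cross-multiplication in the unnormalised rationals and carried over by
  -- such homomorphism laws.
  fromℚᵘ-homo-* : ∀ p q → fromℚᵘ (p ℚᵘ.* q) ≡ fromℚᵘ p * fromℚᵘ q
  fromℚᵘ-homo-* p q = ℚₚ.toℚᵘ-injective (begin-equality
    toℚᵘ (fromℚᵘ (p ℚᵘ.* q))                   ≃⟨ ℚₚ.toℚᵘ-fromℚᵘ (p ℚᵘ.* q) ⟩
    p ℚᵘ.* q                                   ≃⟨ ℚᵘₚ.*-cong (ℚₚ.toℚᵘ-fromℚᵘ p) (ℚₚ.toℚᵘ-fromℚᵘ q) ⟨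
    toℚᵘ (fromℚᵘ p) ℚᵘ.* toℚᵘ (fromℚᵘ q)       ≃⟨ ℚₚ.toℚᵘ-homo-* (fromℚᵘ p) (fromℚᵘ q) ⟨
    toℚᵘ (fromℚᵘ p * fromℚᵘ q)                 ∎)
    where open ℚᵘₚ.≤-Reasoning

  fromℚᵘ-homo-+ : ∀ p q → fromℚᵘ (p ℚᵘ.+ q) ≡ fromℚᵘ p + fromℚᵘ q
  fromℚᵘ-homo-+ p q = ℚₚ.toℚᵘ-injective (begin-equality
    toℚᵘ (fromℚᵘ (p ℚᵘ.+ q))                   ≃⟨ ℚₚ.toℚᵘ-fromℚᵘ (p ℚᵘ.+ q) ⟩
    p ℚᵘ.+ q                                   ≃⟨ ℚᵘₚ.+-cong (ℚₚ.toℚᵘ-fromℚᵘ p) (ℚₚ.toℚᵘ-fromℚᵘ q) ⟨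
    toℚᵘ (fromℚᵘ p) ℚᵘ.+ toℚᵘ (fromℚᵘ q)       ≃⟨ ℚₚ.toℚᵘ-homo-+ (fromℚᵘ p) (fromℚᵘ q) ⟨
    toℚᵘ (fromℚᵘ p + fromℚᵘ q)                 ∎)
    where open ℚᵘₚ.≤-Reasoning

  fromℚᵘ-mono-≤ : ∀ {p q} → p ℚᵘ.≤ q → fromℚᵘ p ℚ.≤ fromℚᵘ q
  fromℚᵘ-mono-≤ {p} {q} p≤q = ℚₚ.toℚᵘ-cancel-≤ (begin
    toℚᵘ (fromℚᵘ p)  ≃⟨ ℚₚ.toℚᵘ-fromℚᵘ p ⟩
    p                ≤⟨ p≤q ⟩
    q                ≃⟨ ℚₚ.toℚᵘ-fromℚᵘ q ⟨
    toℚᵘ (fromℚᵘ q)  ∎)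
    where open ℚᵘₚ.≤-Reasoning

  ι : ℕ → ℚ
  ι n = + n / 1

  ι-homo-+ : ∀ m n → ι (m ℕ.+ n) ≡ ι m + ι n
  ι-homo-+ m n = ≡.trans
    (ℚₚ.fromℚᵘ-cong {mkℚᵘ (+ (m ℕ.+ n)) 0} {mkℚᵘ (+ m) 0 ℚᵘ.+ mkℚᵘ (+ n) 0}
      (*≡* (cong (ℤ._* + 1) (cong₂ ℤ._+_ (≡.sym (ℤₚ.*-identityʳ (+ m))) (≡.sym (ℤₚ.*-identityʳ (+ n)))))))
    (fromℚᵘ-homo-+ (mkℚᵘ (+ m) 0) (mkℚᵘ (+ n) 0))

  ι-homo-* : ∀ m n → ι (m ℕ.* n) ≡ ι m * ι n
  ι-homo-* m n = ≡.trans
    (ℚₚ.fromℚᵘ-cong {mkℚᵘ (+ (m ℕ.* n)) 0} {mkℚᵘ (+ m) 0 ℚᵘ.* mkℚᵘ (+ n) 0}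
      (*≡* (cong (ℤ._* + 1) (ℤₚ.pos-* m n))))
    (fromℚᵘ-homo-* (mkℚᵘ (+ m) 0) (mkℚᵘ (+ n) 0))

  ι-mono-≤ : ∀ {m n} → m ≤ n → ι m ℚ.≤ ι n
  ι-mono-≤ {m} {n} m≤n = fromℚᵘ-mono-≤ {mkℚᵘ (+ m) 0} {mkℚᵘ (+ n) 0}
    (*≤* (ℤₚ.*-monoʳ-≤-nonNeg (+ 1) (ℤ.+≤+ m≤n)))

  1/n*n≡1 : ∀ n .{{_ : ℕ.NonZero n}} → (+ 1 / n) * ι n ≡ 1ℚ
  1/n*n≡1 (suc k) = ≡.trans (≡.sym (fromℚᵘ-homo-* (mkℚᵘ (+ 1) k) (mkℚᵘ (+ suc k) 0)))
    (ℚₚ.fromℚᵘ-cong {mkℚᵘ (+ 1) k ℚᵘ.* mkℚᵘ (+ suc k) 0} {mkℚᵘ (+ 1) 0}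
      (*≡* (≡.trans (ℤₚ.*-identityʳ _) (cong (+ 1 ℤ.*_) (≡.sym (ℤₚ.*-identityʳ (+ suc k)))))))

  1/-pos : ∀ n .{{_ : ℕ.NonZero n}} → 0ℚ ℚ.< + 1 / n
  1/-pos n = ℚₚ.positive⁻¹ (+ 1 / n) {{ℚₚ.normalize-pos 1 n}}

  1/-antimono-≤ : ∀ {m n} → m ≤ n → + 1 / suc n ℚ.≤ + 1 / suc m
  1/-antimono-≤ {m} {n} m≤n = fromℚᵘ-mono-≤ {mkℚᵘ (+ 1) n} {mkℚᵘ (+ 1) m}
    (*≤* (ℤₚ.*-monoˡ-≤-nonNeg (+ 1) (ℤ.+≤+ (s≤s m≤n))))

  *-inverse-unique : ∀ {p q r} → p * r ≡ 1ℚ → q * r ≡ 1ℚ → p ≡ q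
  *-inverse-unique {p} {q} {r} pr≡1 qr≡1 = begin
    p            ≡⟨ ℚₚ.*-identityʳ p ⟨
    p * 1ℚ       ≡⟨ cong (p *_) qr≡1 ⟨
    p * (q * r)  ≡⟨ x∙yz≈y∙xz p q r ⟩
    q * (p * r)  ≡⟨ cong (q *_) pr≡1 ⟩
    q * 1ℚ       ≡⟨ ℚₚ.*-identityʳ q ⟩
    q            ∎
    where open ≡.≡-Reasoning

  k!*nCk*[n∸k]!≡n! : ∀ {n k} → k ≤ n → k ! ℕ.* (n C k) ℕ.* (n ∸ k) ! ≡ n !
  k!*nCk*[n∸k]!≡n! {n} {k} k≤n = begin
    k ! ℕ.* (n C k) ℕ.* (n ∸ k) !      ≡⟨ rearrange (k !) (n C k) ((n ∸ k) !) ⟩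
    (n C k) ℕ.* (k ! ℕ.* (n ∸ k) !)    ≡⟨ cong (ℕ._* (k ! ℕ.* (n ∸ k) !)) (nCk≡n!/k![n-k]! k≤n) ⟩
    (n ! ℕ./ (k ! ℕ.* (n ∸ k) !)) ℕ.* (k ! ℕ.* (n ∸ k) !)  ≡⟨ ℕ.m/n*n≡m (k![n∸k]!∣n! k≤n) ⟩
    n !                                ∎
    where
    open ≡.≡-Reasoning
    instance
      _ = k ℕₚ.!* (n ∸ k) !≢0
    rearrange : ∀ a b c → a ℕ.* b ℕ.* c ≡ b ℕ.* (a ℕ.* c)
    rearrange = ℕSolver.solve-∀

  -- The number `k ! * (n C k)` is the falling factorial of n, and this is its recursion; multiplied
  -- by (n - k - 1)!, both sides become n!.
  [1+k]!*nC[1+k]≡k!*nCk*[n∸k] : ∀ {n k} → k < n →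
    suc k ! ℕ.* (n C suc k) ≡ k ! ℕ.* (n C k) ℕ.* (n ∸ k)
  [1+k]!*nC[1+k]≡k!*nCk*[n∸k] {n} {k} k<n =
    ℕₚ.*-cancelʳ-≡ _ _ ((n ∸ suc k) !) {{(n ∸ suc k) !≢0}} (begin
      suc k ! ℕ.* (n C suc k) ℕ.* (n ∸ suc k) !            ≡⟨ k!*nCk*[n∸k]!≡n! k<n ⟩
      n !                                                  ≡⟨ k!*nCk*[n∸k]!≡n! (ℕₚ.<⇒≤ k<n) ⟨
      k ! ℕ.* (n C k) ℕ.* (n ∸ k) !                        ≡⟨ cong (k ! ℕ.* (n C k) ℕ.*_) ([n-k]*[n-k-1]!≡[n-k]! k<n) ⟨
      k ! ℕ.* (n C k) ℕ.* ((n ∸ k) ℕ.* (n ∸ suc k) !)      ≡⟨ ℕₚ.*-assoc (k ! ℕ.* (n C k)) (n ∸ k) ((n ∸ suc k) !) ⟨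
      k ! ℕ.* (n C k) ℕ.* (n ∸ k) ℕ.* (n ∸ suc k) !        ∎)
    where open ≡.≡-Reasoning

  -- The reciprocal of (1 + m) - j, for j ≤ m.
  κ : ℕ → ℕ → ℚ
  κ m j = + 1 / suc (m ∸ j)

  -- For k ≤ 1 + m, the reciprocal of the falling factorial d (d - 1) ⋯ (d - k + 1) with d = 1 + m.
  -- Its recursion has the shape of `∏`, so that it can be split off from a normalised binomial
  -- factor by factor.
  ∏κ : ℕ → ℕ → ℚ
  ∏κ m zero    = 1ℚ
  ∏κ m (suc k) = ∏κ m k * κ m k

  [d-j]*κ≡1 : ∀ m j → j < suc m → (ι (suc m) - ι j) * κ m j ≡ 1ℚ
  [d-j]*κ≡1 m j (s≤s j≤m) = begin
    (ι (suc m) - ι j) * κ m j                  ≡⟨ cong (λ n → (ι n - ι j) * κ m j) d≡j+[d-j] ⟩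
    (ι (j ℕ.+ suc (m ∸ j)) - ι j) * κ m j      ≡⟨ cong (λ p → (p - ι j) * κ m j) (ι-homo-+ j (suc (m ∸ j))) ⟩
    (ι j + ι (suc (m ∸ j)) - ι j) * κ m j
      ≡⟨ solve 3 (λ p q r → (p :+ q :- p) :* r := r :* q) ≡.refl (ι j) (ι (suc (m ∸ j))) (κ m j) ⟩
    κ m j * ι (suc (m ∸ j))                    ≡⟨ 1/n*n≡1 (suc (m ∸ j)) ⟩
    1ℚ                                         ∎
    where
    open ≡.≡-Reasoning
    open +-*-Solver
    d≡j+[d-j] : suc m ≡ j ℕ.+ suc (m ∸ j)
    d≡j+[d-j] = ≡.sym (≡.trans (ℕₚ.+-suc j (m ∸ j)) (cong suc (ℕₚ.m+[n∸m]≡n j≤m)))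

  ∏κ*k!*dCk≡1 : ∀ m k → k ≤ suc m → ∏κ m k * ι (k ! ℕ.* (suc m C k)) ≡ 1ℚ
  ∏κ*k!*dCk≡1 m zero    _ = ≡.refl
  ∏κ*k!*dCk≡1 m (suc k) (s≤s k≤m) = begin
    ∏κ m k * κ m k * ι (suc k ! ℕ.* (suc m C suc k))
      ≡⟨ cong (λ n → ∏κ m k * κ m k * ι n) ([1+k]!*nC[1+k]≡k!*nCk*[n∸k] (s≤s k≤m)) ⟩
    ∏κ m k * κ m k * ι (k ! ℕ.* (suc m C k) ℕ.* (suc m ∸ k))
      -- With k ≤ m the truncated difference d - k takes the successor form that is the denominator
      -- of `κ m k`.
      ≡⟨ cong (λ n → ∏κ m k * κ m k * ι (k ! ℕ.* (suc m C k) ℕ.* n)) (ℕₚ.+-∸-assoc 1 k≤m) ⟩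
    ∏κ m k * κ m k * ι (k ! ℕ.* (suc m C k) ℕ.* suc (m ∸ k))
      ≡⟨ cong (∏κ m k * κ m k *_) (ι-homo-* (k ! ℕ.* (suc m C k)) (suc (m ∸ k))) ⟩
    ∏κ m k * κ m k * (ι (k ! ℕ.* (suc m C k)) * ι (suc (m ∸ k)))
      ≡⟨ interchange (∏κ m k) (κ m k) (ι (k ! ℕ.* (suc m C k))) (ι (suc (m ∸ k))) ⟩
    ∏κ m k * ι (k ! ℕ.* (suc m C k)) * (κ m k * ι (suc (m ∸ k)))
      ≡⟨ cong₂ _*_ (∏κ*k!*dCk≡1 m k (ℕₚ.m≤n⇒m≤1+n k≤m)) (1/n*n≡1 (suc (m ∸ k))) ⟩
    1ℚ * 1ℚ  ≡⟨⟩
    1ℚ       ∎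
    where open ≡.≡-Reasoning

  -- Both sides are inverse to `k ! * (d C k)`, and inverses are unique.
  1/k!*1/dCk≡∏κ : ∀ m k (k≤d : k ≤ suc m) →
    ((+ 1 / k !) {{k !≢0}}) * ((+ 1 / (suc m C k)) {{nCk≢0 (suc m) k k≤d}}) ≡ ∏κ m k
  1/k!*1/dCk≡∏κ m k k≤d = *-inverse-unique (begin
    1/k! * 1/dCk * ι (k ! ℕ.* (suc m C k))        ≡⟨ cong (1/k! * 1/dCk *_) (ι-homo-* (k !) (suc m C k)) ⟩
    1/k! * 1/dCk * (ι (k !) * ι (suc m C k))      ≡⟨ interchange 1/k! 1/dCk (ι (k !)) (ι (suc m C k)) ⟩
    1/k! * ι (k !) * (1/dCk * ι (suc m C k))      ≡⟨ cong₂ _*_ (1/n*n≡1 (k !) {{k !≢0}})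
                                                       (1/n*n≡1 (suc m C k) {{nCk≢0 (suc m) k k≤d}}) ⟩
    1ℚ * 1ℚ                                       ≡⟨⟩
    1ℚ                                            ∎)
    (∏κ*k!*dCk≡1 m k k≤d)
    where
    open ≡.≡-Reasoning
    1/k! 1/dCk : ℚ
    1/k!  = (+ 1 / k !) {{k !≢0}}
    1/dCk = (+ 1 / (suc m C k)) {{nCk≢0 (suc m) k k≤d}}

-- Transfer to the coefficients of a polynomial of degree 1 + m.

module _ (m : ℕ) where
  open RationalConstants
  open RealOrder hiding (*-pos; *-nonNeg)
  open OrderedRingProperties ℝ-orderedCommutativeRing
  open import Data.Integer.Base using (+_)
  open import Data.Nat.Combinatorics using (_C_)
  open import Data.Rational.Base as ℚ using (_/_)
  import Data.Rational.Properties as ℚₚ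
  open import Algebra.Properties.CommutativeSemigroup
    (CommutativeMonoid.commutativeSemigroup ℚₚ.*-1-commutativeMonoid) using (interchange)

  open NormalisedBinomial (suc m) ⟦_⟧ (λ j → fromℚ (κ m j))
    (λ {i} {j} i≤j → pointwise-≤ ⟦ i ⟧ ⟦ j ⟧ λ _ → ι-mono-≤ i≤j)
    -- Truncated subtraction keeps `κ m j` equal to 1 beyond j = m, so positivity and monotonicity
    -- hold at every index; only the inverse law asks for j < d.
    (λ j → fromℚ-mono-< (1/-pos (suc (m ∸ j))))
    (λ {i} {j} i≤j → pointwise-≤ (fromℚ (κ m i)) (fromℚ (κ m j))
      λ _ → 1/-antimono-≤ (ℕₚ.∸-monoʳ-≤ m i≤j))
    (λ j j<d → pointwise-≃ ((⟦ suc m ⟧ -ℝ ⟦ j ⟧) *ℝ fromℚ (κ m j)) ⟦ 1 ⟧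
      λ _ → [d-j]*κ≡1 m j j<d)

  -- Regrouping the factors separates the numerators y - j from the constants 1 / (d - j). The
  -- identity is exact at each index, not just in the limit.
  seq-normalisedBinom : ∀ y k n →
    seq (normalisedBinom y k) n ≡ seq (fallingFactorial y k) n ℚ.* ∏κ m k
  seq-normalisedBinom y zero    n = ≡.refl
  seq-normalisedBinom y (suc k) n = ≡.trans
    (cong (ℚ._* ((seq y n ℚ.- ι k) ℚ.* κ m k)) (seq-normalisedBinom y k n))
    (interchange (seq (fallingFactorial y k) n) (∏κ m k) (seq y n ℚ.- ι k) (κ m k))

  module _ (x : ℕ → ℝ) (f : Polynomial (suc m))
    (coeff≃binom : ∀ i → coeff f i ≃ binom (x (toℕ i)) (toℕ i)) where

    p : ℕ → ℝ
    p k = normalisedBinom (x k) k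

    1/dC : Fin (suc (suc m)) → ℝ
    1/dC i = fromℚ ((+ 1 / (suc m C toℕ i)) {{nCk≢0 (suc m) (toℕ i) (Finₚ.toℕ≤pred[n] i)}})

    -- The reciprocal of `k !` inside `binom` and that of `d C k` from the normalisation merge into
    -- `∏κ`, the constant by which `p` differs from a falling factorial.
    normalised≃p : ∀ i → normalised f i ≃ p (toℕ i)
    normalised≃p i =
      ≃-trans (normalised f i) (binom y k *ℝ 1/dC i) (p k)
        (*ℝ-congʳ (1/dC i) (coeff f i) (binom y k) (coeff≃binom i))
        (pointwise-≃ (binom y k *ℝ 1/dC i) (p k) λ n →
          ≡.trans (ℚₚ.*-assoc (seq (fallingFactorial y k) n) _ _)
            (≡.trans (cong (seq (fallingFactorial y k) n ℚ.*_) (1/k!*1/dCk≡∏κ m k (Finₚ.toℕ≤pred[n] i)))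
              (≡.sym (seq-normalisedBinom y k n))))
      where
      k : ℕ
      k = toℕ i
      y : ℝ
      y = x k

    0<p : (∀ i → ⟦ 0 ⟧ <ℝ coeff f i) → ∀ i → ⟦ 0 ⟧ <ℝ p (toℕ i)
    0<p 0<coeff i = <ℝ-≤ℝ-trans ⟦ 0 ⟧ (normalised f i) (p (toℕ i))
      (*-pos {x = coeff f i} {y = 1/dC i} (0<coeff i)
        (fromℚ-mono-< (1/-pos (suc m C toℕ i) {{nCk≢0 (suc m) (toℕ i) (Finₚ.toℕ≤pred[n] i)}})))
      (≃⇒≤ℝ (normalised f i) (p (toℕ i)) (normalised≃p i))

    log-concave : UltraLogConcave f → ∀ h i j → toℕ i ≡ suc (toℕ h) → toℕ j ≡ suc (toℕ i) →
      p (toℕ h) *ℝ p (toℕ j) ≤ℝ p (toℕ i) *ℝ p (toℕ i)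
    log-concave ulc h i j i≡1+h j≡1+i =
      ≤ℝ-trans (p (toℕ h) *ℝ p (toℕ j)) (normalised f h *ℝ normalised f j) (p (toℕ i) *ℝ p (toℕ i))
        (≃⇒≤ℝ (p (toℕ h) *ℝ p (toℕ j)) (normalised f h *ℝ normalised f j)
          (≃-sym (normalised f h *ℝ normalised f j) (p (toℕ h) *ℝ p (toℕ j))
            (*ℝ-cong (normalised f h) (p (toℕ h)) (normalised f j) (p (toℕ j))
              (normalised≃p h) (normalised≃p j))))
        (≤ℝ-trans (normalised f h *ℝ normalised f j) (normalised f i *ℝ normalised f i)
          (p (toℕ i) *ℝ p (toℕ i))
          (ulc h i j i≡1+h j≡1+i)
          (≃⇒≤ℝ (normalised f i *ℝ normalised f i) (p (toℕ i) *ℝ p (toℕ i))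
            (*ℝ-cong (normalised f i) (p (toℕ i)) (normalised f i) (p (toℕ i))
              (normalised≃p i) (normalised≃p i))))

    x-decreasing : (∀ i → 1 ≤ i → i ≤ suc m → ⟦ i ∸ 1 ⟧ ≤ℝ x i) →
      (∀ i → ⟦ 0 ⟧ <ℝ coeff f i) → UltraLogConcave f → ⟦ suc m ⟧ ≤ℝ x (suc m) →
      ∀ i → suc i < suc m → x (2 ℕ.+ i) ≤ℝ x (1 ℕ.+ i)
    x-decreasing ν≤x 0<coeff ulc d≤xd = roots-decreasing x
      (λ i 1+i≤d → ν≤x (suc i) (s≤s z≤n) 1+i≤d)
      (λ i i≤d → subst (λ k → ⟦ 0 ⟧ <ℝ p k) (toℕ-index i≤d) (0<p 0<coeff (index i≤d)))
      (λ i 2+i≤d →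
        let 1+i≤d = ℕₚ.<⇒≤ 2+i≤d
            i≤d   = ℕₚ.<⇒≤ 1+i≤d
            h≡ = toℕ-index i≤d
            i≡ = toℕ-index 1+i≤d
            j≡ = toℕ-index 2+i≤d
        -- `toℕ` undoes `fromℕ<` only propositionally, so all three exponents are transported at
        -- once, the outer two as a pair.
        in ≡.subst₂ (λ { (k , l) n → p k *ℝ p l ≤ℝ p n *ℝ p n }) (cong₂ _,_ h≡ j≡) i≡
             (log-concave ulc (index i≤d) (index 1+i≤d) (index 2+i≤d)
               (≡.trans i≡ (cong suc (≡.sym h≡))) (≡.trans j≡ (cong suc (≡.sym i≡)))))
      d≤xd
      where
      index : ∀ {i} → i ≤ suc m → Fin (suc (suc m))
      index i≤d = fromℕ< (s≤s i≤d)
      toℕ-index : ∀ {i} (i≤d : i ≤ suc m) → toℕ (index i≤d) ≡ i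
      toℕ-index i≤d = Finₚ.toℕ-fromℕ< (s≤s i≤d)

theorem3p1 : (d : ℕ) → 1 ≤ d →
    (x : ℕ → ℝ) →
    (∀ i → 1 ≤ i → i ≤ d → ⟦ i ∸ 1 ⟧ ≤ℝ x i) →
    (f : Polynomial d) →
    coeff f zero ≃ ⟦ 1 ⟧ →
    (∀ (i : Fin d) → coeff f (suc i) ≃ binom (x (suc (toℕ i))) (suc (toℕ i))) →
    (∀ i → ⟦ 0 ⟧ <ℝ coeff f i) →
    UltraLogConcave f →
    ⟦ d ⟧ ≤ℝ x d →
    ∀ i → 1 ≤ i → i < d → x (suc i) ≤ℝ x i
theorem3p1 (suc m) _ x ν≤x f f₀≃1 f≃binom 0<f ulc d≤xd (suc i) _ 1+i<d =
  x-decreasing m x f coeff≃binom ν≤x 0<f ulc d≤xd i 1+i<d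
  where
  coeff≃binom : ∀ i → coeff f i ≃ binom (x (toℕ i)) (toℕ i)
  -- A binomial with lower index 0 is 1 for any `x 0`, so the constant coefficient fits the formula
  -- of the others.
  coeff≃binom zero    = RealOrder.≃-trans (coeff f zero) ⟦ 1 ⟧ (binom (x 0) 0) f₀≃1
    (RealOrder.pointwise-≃ ⟦ 1 ⟧ (binom (x 0) 0) λ _ → ≡.refl)
  coeff≃binom (suc i) = f≃binom i
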